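{- For all integers $n\ge0$, $r\ge0$ and every real $x\ne0$, the $r$th derivative of $\mathfrak{C}_n$ satisfies $$\mathfrak{C}_n^{(r)}(x)=\frac{r!}{x^r}\sum_{k=0}^{r}\binom rk(-1)^{r-k}\sum_{j_0+j_1+\cdots+j_k=n}\binom{n}{j_0,j_1,\dots,j_k}\mathfrak{C}_{j_0}(x)\mathfrak{C}_{j_1}(x)\cdots\mathfrak{C}_{j_k}(x),$$ where the inner sum runs over all tuples of non-negative integers $(j_0,\dots,j_k)$ with sum $n$.
   Context: For $n\ge1$ the central factorial is $x^{[n]}=x\,(x+\tfrac n2-1)(x+\tfrac n2-2)\cdots(x-\tfrac n2+1)$ (a product of $n$ factors), and $x^{[0]}=1$. The central factorial numbers of the second kind $T(n,k)$ ($0\le k\le n$) are defined by $x^n=\sum_{k=0}^n T(n,k)\,x^{[k]}$; equivalently $T(n,k)=\frac1{k!}\sum_{j=0}^k(-1)^j\binom kj\left(\frac k2-j\right)^n$, and $T(n,k)=0$ for $k>n$. The $n$th central Fubini-like polynomial is $\mathfrak{C}_n(x)=\sum_{k=0}^n k!\,T(n,k)\,x^k$. -}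

module Defs where

open import Algebra.Bundles using (CommutativeRing; Semiring)
import Algebra.Definitions.RawSemiring
import Algebra.Properties.Semiring.Sum
open import Data.Fin using (Fin; toℕ)
open import Data.Fin.Properties using (toℕ<n)
open import Data.Integer as ℤ using () renaming (+_ to pos)
import Data.Integer.Tactic.RingSolver as ℤSolver
open import Data.List using (List; []; _∷_; map; concatMap; foldr; upTo)
open import Data.Nat as ℕ using (ℕ; zero; suc; _∸_; _!)
open import Data.Nat.Combinatorics using (_C_; nCk+nC[k+1]≡[n+1]C[k+1]; k>n⇒nCk≡0)
import Data.Nat.Properties as ℕₚ
open import Data.Product using (∃; _×_; _,_; proj₁; proj₂; ∃-syntax)
open import Data.Rational as Rat using (ℚ; 0ℚ; 1ℚ; ½)
import Data.Rational.Properties as ℚₚ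
open import Data.Rational.Solver using (module +-*-Solver)
import Data.Rational.Unnormalised as ℚᵘ
import Data.Rational.Unnormalised.Properties as ℚᵘₚ
open import Data.Sum using (_⊎_; inj₁; inj₂)
open import Data.Vec as Vec using (Vec; []; _∷_; lookup)
open import Level using (0ℓ)
open import Relation.Binary.PropositionalEquality
  using (_≡_; refl; sym; trans; cong; cong₂; subst; module ≡-Reasoning)
open import Relation.Binary.Structures using (IsEquivalence)
open import Relation.Nullary using (yes; no; contradiction)

module Estimates where
  open Rat hiding (ℚ; 0ℚ; 1ℚ; ½)
  open ℚₚ.≤-Reasoning
  open +-*-Solver

  0<½*_ : ∀ {ε} → 0ℚ < ε → 0ℚ < ½ * ε
  0<½*_ {ε} 0<ε = ℚₚ.positive⁻¹ (½ * ε) {{ℚₚ.pos*pos⇒pos ½ ε {{positive 0<ε}}}}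

  ½+½ : ∀ ε → ½ * ε + ½ * ε ≡ ε
  ½+½ = solve 1 (λ e → con ½ :* e :+ con ½ :* e := e) refl

  dist-triangle : ∀ a b c → ∣ a - c ∣ ≤ ∣ a - b ∣ + ∣ b - c ∣
  dist-triangle a b c = begin
    ∣ a - c ∣                 ≡⟨ cong ∣_∣ (solve 3 (λ a b c → a :- c := (a :- b) :+ (b :- c)) refl a b c) ⟩
    ∣ (a - b) + (b - c) ∣     ≤⟨ ℚₚ.∣p+q∣≤∣p∣+∣q∣ (a - b) (b - c) ⟩
    ∣ a - b ∣ + ∣ b - c ∣     ∎

  dist-sym : ∀ a b → ∣ a - b ∣ ≡ ∣ b - a ∣
  dist-sym a b = trans (cong ∣_∣ (solve 2 (λ a b → a :- b := :- (b :- a)) refl a b))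
                       (ℚₚ.∣-p∣≡∣p∣ (b - a))

  dist-zero : ∀ {a b} → a ≡ b → ∣ a - b ∣ ≡ 0ℚ
  dist-zero {a} refl = cong ∣_∣ (ℚₚ.+-inverseʳ a)

  dist-trans : ∀ {a b c ε} → ∣ a - b ∣ < ½ * ε → ∣ b - c ∣ < ½ * ε → ∣ a - c ∣ < ε
  dist-trans {a} {b} {c} {ε} p q = begin-strict
    ∣ a - c ∣               ≤⟨ dist-triangle a b c ⟩
    ∣ a - b ∣ + ∣ b - c ∣   <⟨ ℚₚ.+-mono-< p q ⟩
    ½ * ε + ½ * ε           ≡⟨ ½+½ ε ⟩
    ε                       ∎

  dist-+ : ∀ {a a′ b b′ ε} → ∣ a - a′ ∣ < ½ * ε → ∣ b - b′ ∣ < ½ * ε →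
           ∣ (a + b) - (a′ + b′) ∣ < ε
  dist-+ {a} {a′} {b} {b′} {ε} p q = begin-strict
    ∣ (a + b) - (a′ + b′) ∣     ≡⟨ cong ∣_∣ (solve 4 (λ a a′ b b′ →
                                     (a :+ b) :- (a′ :+ b′) := (a :- a′) :+ (b :- b′)) refl a a′ b b′) ⟩
    ∣ (a - a′) + (b - b′) ∣     ≤⟨ ℚₚ.∣p+q∣≤∣p∣+∣q∣ (a - a′) (b - b′) ⟩
    ∣ a - a′ ∣ + ∣ b - b′ ∣     <⟨ ℚₚ.+-mono-< p q ⟩
    ½ * ε + ½ * ε               ≡⟨ ½+½ ε ⟩
    ε                           ∎

  dist-neg : ∀ a b → ∣ (- a) - (- b) ∣ ≡ ∣ a - b ∣
  dist-neg a b = trans (cong ∣_∣ (solve 2 (λ a b → (:- a) :- (:- b) := :- (a :- b)) refl a b))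
                       (ℚₚ.∣-p∣≡∣p∣ (a - b))

  ∣a∣≤∣a-b∣+∣b∣ : ∀ a b → ∣ a ∣ ≤ ∣ a - b ∣ + ∣ b ∣
  ∣a∣≤∣a-b∣+∣b∣ a b = begin
    ∣ a ∣               ≡⟨ cong ∣_∣ (solve 2 (λ a b → a := (a :- b) :+ b) refl a b) ⟩
    ∣ (a - b) + b ∣     ≤⟨ ℚₚ.∣p+q∣≤∣p∣+∣q∣ (a - b) b ⟩
    ∣ a - b ∣ + ∣ b ∣   ∎

  dist-abs : ∀ a b → ∣ ∣ a ∣ - ∣ b ∣ ∣ ≤ ∣ a - b ∣
  dist-abs a b with ℚₚ.∣p∣≡p∨∣p∣≡-p (∣ a ∣ - ∣ b ∣)
  ... | inj₁ e = begin
    ∣ ∣ a ∣ - ∣ b ∣ ∣             ≡⟨ e ⟩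
    ∣ a ∣ - ∣ b ∣                 ≤⟨ ℚₚ.+-monoˡ-≤ (- ∣ b ∣) (∣a∣≤∣a-b∣+∣b∣ a b) ⟩
    (∣ a - b ∣ + ∣ b ∣) - ∣ b ∣   ≡⟨ solve 2 (λ d b → (d :+ b) :- b := d) refl (∣ a - b ∣) (∣ b ∣) ⟩
    ∣ a - b ∣                     ∎
  ... | inj₂ e = begin
    ∣ ∣ a ∣ - ∣ b ∣ ∣             ≡⟨ e ⟩
    - (∣ a ∣ - ∣ b ∣)             ≡⟨ solve 2 (λ a b → :- (a :- b) := b :- a) refl (∣ a ∣) (∣ b ∣) ⟩
    ∣ b ∣ - ∣ a ∣                 ≤⟨ ℚₚ.+-monoˡ-≤ (- ∣ a ∣) (∣a∣≤∣a-b∣+∣b∣ b a) ⟩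
    (∣ b - a ∣ + ∣ a ∣) - ∣ a ∣   ≡⟨ solve 2 (λ d b → (d :+ b) :- b := d) refl (∣ b - a ∣) (∣ a ∣) ⟩
    ∣ b - a ∣                     ≡⟨ dist-sym b a ⟩
    ∣ a - b ∣                     ∎

  q≤∣q∣ : ∀ q → q ≤ ∣ q ∣
  q≤∣q∣ q with ℚₚ.≤-total 0ℚ q
  ... | inj₁ 0≤q = ℚₚ.≤-reflexive (sym (ℚₚ.0≤p⇒∣p∣≡p 0≤q))
  ... | inj₂ q≤0 = ℚₚ.≤-trans q≤0 (ℚₚ.0≤∣p∣ q)

  a+c≤0⇒c≤∣a∣ : ∀ a c → a + c ≤ 0ℚ → c ≤ ∣ a ∣
  a+c≤0⇒c≤∣a∣ a c a+c≤0 = begin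
    c               ≡⟨ solve 2 (λ a c → c := (a :+ c) :+ (:- a)) refl a c ⟩
    (a + c) + - a   ≤⟨ ℚₚ.+-monoˡ-≤ (- a) a+c≤0 ⟩
    0ℚ + - a        ≡⟨ ℚₚ.+-identityˡ (- a) ⟩
    - a             ≤⟨ q≤∣q∣ (- a) ⟩
    ∣ - a ∣         ≡⟨ ℚₚ.∣-p∣≡∣p∣ a ⟩
    ∣ a ∣           ∎

  0<c²ε : ∀ {c ε} → 0ℚ < c → 0ℚ < ε → 0ℚ < (c * c) * ε
  0<c²ε {c} {ε} 0<c 0<ε = ℚₚ.positive⁻¹ ((c * c) * ε)
    {{ℚₚ.pos*pos⇒pos (c * c) {{ℚₚ.pos*pos⇒pos c {{positive 0<c}} c {{positive 0<c}}}} ε {{positive 0<ε}}}}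

  0<1+∣_∣ : ∀ q → 0ℚ < 1ℚ + ∣ q ∣
  0<1+∣ q ∣ = ℚₚ.<-≤-trans (ℚₚ.positive⁻¹ 1ℚ)
    (subst (_≤ 1ℚ + ∣ q ∣) (ℚₚ.+-identityʳ 1ℚ) (ℚₚ.+-monoʳ-≤ 1ℚ (ℚₚ.0≤∣p∣ q)))

  *-tolerance : ∀ {B ε} → 0ℚ < B → 0ℚ < ε → ∃[ δ ] (0ℚ < δ × B * δ ≡ ½ * ε)
  *-tolerance {B} {ε} 0<B 0<ε = δ , 0<δ , B*δ≡½*ε
    where
    instance
      B⁺ : Positive B
      B⁺ = positive 0<B
      B≢0 : NonZero B
      B≢0 = ℚₚ.pos⇒nonZero B
      1/B⁺ : Positive (1/ B)
      1/B⁺ = ℚₚ.1/pos⇒pos B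
      ½ε⁺ : Positive (½ * ε)
      ½ε⁺ = positive (0<½* 0<ε)
    δ = 1/ B * (½ * ε)
    0<δ = ℚₚ.positive⁻¹ δ {{ℚₚ.pos*pos⇒pos (1/ B) (½ * ε)}}
    B*δ≡½*ε : B * δ ≡ ½ * ε
    B*δ≡½*ε = trans (sym (ℚₚ.*-assoc B (1/ B) (½ * ε)))
             (trans (cong (_* (½ * ε)) (ℚₚ.*-inverseʳ B)) (ℚₚ.*-identityˡ (½ * ε)))

  *-bound : ∀ {B δ a d} → 0ℚ < B → ∣ a ∣ ≤ B → ∣ d ∣ < δ → ∣ a * d ∣ < B * δ
  *-bound {B} {δ} {a} {d} 0<B a≤B d<δ = begin-strict
    ∣ a * d ∣       ≡⟨ ℚₚ.∣p*q∣≡∣p∣*∣q∣ a d ⟩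
    ∣ a ∣ * ∣ d ∣   ≤⟨ ℚₚ.*-monoʳ-≤-nonNeg ∣ d ∣ {{ℚₚ.∣-∣-nonNeg d}} a≤B ⟩
    B * ∣ d ∣       <⟨ ℚₚ.*-monoʳ-<-pos B {{positive 0<B}} d<δ ⟩
    B * δ           ∎

  dist-* : ∀ {A B ε δ₁ δ₂ a a′ b b′} → 0ℚ < A → 0ℚ < B →
           A * δ₁ ≡ ½ * ε → B * δ₂ ≡ ½ * ε →
           ∣ a ∣ ≤ A → ∣ b′ ∣ ≤ B → ∣ a - a′ ∣ < δ₂ → ∣ b - b′ ∣ < δ₁ →
           ∣ a * b - a′ * b′ ∣ < ε
  dist-* {A} {B} {ε} {δ₁} {δ₂} {a} {a′} {b} {b′} 0<A 0<B eA eB a≤A b≤B p q = begin-strict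
    ∣ a * b - a′ * b′ ∣                        ≡⟨ cong ∣_∣ (solve 4 (λ a a′ b b′ →
                                                    a :* b :- a′ :* b′ := a :* (b :- b′) :+ b′ :* (a :- a′))
                                                    refl a a′ b b′) ⟩
    ∣ a * (b - b′) + b′ * (a - a′) ∣           ≤⟨ ℚₚ.∣p+q∣≤∣p∣+∣q∣ (a * (b - b′)) (b′ * (a - a′)) ⟩
    ∣ a * (b - b′) ∣ + ∣ b′ * (a - a′) ∣       <⟨ ℚₚ.+-mono-< (*-bound {a = a} {b - b′} 0<A a≤A q) (*-bound {a = b′} {a - a′} 0<B b≤B p) ⟩
    A * δ₁ + B * δ₂                            ≡⟨ cong₂ _+_ eA eB ⟩
    ½ * ε + ½ * ε                              ≡⟨ ½+½ ε ⟩
    ε                                          ∎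

  recip : ℚ → ℚ
  recip q with q ℚₚ.≟ 0ℚ
  ... | yes _  = 0ℚ
  ... | no q≢0 = (1/ q) {{≢-nonZero q≢0}}

  recip-inverse : ∀ {c q} → 0ℚ < c → c ≤ ∣ q ∣ → q * recip q ≡ 1ℚ
  recip-inverse {c} {q} 0<c c≤q with q ℚₚ.≟ 0ℚ
  ... | yes refl = contradiction (ℚₚ.<-≤-trans 0<c c≤q) (ℚₚ.<-irrefl refl)
  ... | no q≢0   = ℚₚ.*-inverseʳ q {{≢-nonZero q≢0}}

  c*recip≤1 : ∀ {c q} → 0ℚ < c → c ≤ ∣ q ∣ → c * ∣ recip q ∣ ≤ 1ℚ
  c*recip≤1 {c} {q} 0<c c≤q = begin
    c * ∣ recip q ∣       ≤⟨ ℚₚ.*-monoʳ-≤-nonNeg ∣ recip q ∣ {{ℚₚ.∣-∣-nonNeg (recip q)}} c≤q ⟩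
    ∣ q ∣ * ∣ recip q ∣   ≡⟨ ℚₚ.∣p*q∣≡∣p∣*∣q∣ q (recip q) ⟨
    ∣ q * recip q ∣       ≡⟨ cong ∣_∣ (recip-inverse 0<c c≤q) ⟩
    1ℚ                    ∎

  dist-recip : ∀ {c ε a b} → 0ℚ < c → c ≤ ∣ a ∣ → c ≤ ∣ b ∣ →
               ∣ a - b ∣ < (c * c) * ε → ∣ recip a - recip b ∣ < ε
  dist-recip {c} {ε} {a} {b} 0<c c≤a c≤b p =
    ℚₚ.*-cancelˡ-<-nonNeg (c * c) {{ℚₚ.pos⇒nonNeg (c * c) {{ℚₚ.pos*pos⇒pos c c}}}} (begin-strict
      (c * c) * ∣ ra - rb ∣
        ≡⟨ cong (λ t → (c * c) * ∣ t ∣) ra-rb ⟩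
      (c * c) * ∣ (ra * rb) * (b - a) ∣
        ≡⟨ cong ((c * c) *_) (trans (ℚₚ.∣p*q∣≡∣p∣*∣q∣ (ra * rb) (b - a)) (cong (_* ∣ b - a ∣) (ℚₚ.∣p*q∣≡∣p∣*∣q∣ ra rb))) ⟩
      (c * c) * ((∣ ra ∣ * ∣ rb ∣) * ∣ b - a ∣)
        ≡⟨ solve 4 (λ c p q d → (c :* c) :* ((p :* q) :* d) := (c :* p) :* ((c :* q) :* d)) refl c (∣ ra ∣) (∣ rb ∣) (∣ b - a ∣) ⟩
      (c * ∣ ra ∣) * ((c * ∣ rb ∣) * ∣ b - a ∣)
        ≤⟨ ℚₚ.*-monoʳ-≤-nonNeg ((c * ∣ rb ∣) * ∣ b - a ∣) {{nn}} (c*recip≤1 0<c c≤a) ⟩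
      1ℚ * ((c * ∣ rb ∣) * ∣ b - a ∣)
        ≡⟨ ℚₚ.*-identityˡ _ ⟩
      (c * ∣ rb ∣) * ∣ b - a ∣
        ≤⟨ ℚₚ.*-monoʳ-≤-nonNeg ∣ b - a ∣ {{ℚₚ.∣-∣-nonNeg (b - a)}} (c*recip≤1 0<c c≤b) ⟩
      1ℚ * ∣ b - a ∣
        ≡⟨ ℚₚ.*-identityˡ _ ⟩
      ∣ b - a ∣
        ≡⟨ dist-sym b a ⟩
      ∣ a - b ∣
        <⟨ p ⟩
      (c * c) * ε ∎)
    where
    ra = recip a
    rb = recip b
    instance
      c⁺ : Positive c
      c⁺ = positive 0<c
    nn : NonNegative ((c * ∣ rb ∣) * ∣ b - a ∣)
    nn = ℚₚ.nonNeg*nonNeg⇒nonNeg (c * ∣ rb ∣)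
           {{ℚₚ.nonNeg*nonNeg⇒nonNeg c {{ℚₚ.pos⇒nonNeg c}} ∣ rb ∣ {{ℚₚ.∣-∣-nonNeg rb}}}}
           ∣ b - a ∣ {{ℚₚ.∣-∣-nonNeg (b - a)}}
    ra-rb : ra - rb ≡ (ra * rb) * (b - a)
    ra-rb = begin-equality
      ra - rb                          ≡⟨ solve 2 (λ p q → p :- q := p :* con 1ℚ :- q :* con 1ℚ) refl ra rb ⟩
      ra * 1ℚ - rb * 1ℚ                ≡⟨ cong₂ (λ s t → ra * s - rb * t) (recip-inverse 0<c c≤b) (recip-inverse 0<c c≤a) ⟨
      ra * (b * rb) - rb * (a * ra)    ≡⟨ solve 4 (λ a b p q → p :* (b :* q) :- q :* (a :* p) := (p :* q) :* (b :- a)) refl a b ra rb ⟩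
      (ra * rb) * (b - a)              ∎

-- Real numbers are Cauchy sequences of rationals; two of them are equal (_≈_)
-- when their difference is a null sequence. Operations are termwise.
module Real where
  open Estimates

  Eventually : (ℕ → Set) → Set
  Eventually P = ∃[ N ] (∀ n → N ℕ.≤ n → P n)

  IsCauchy : (ℕ → ℚ) → Set
  IsCauchy s = ∀ ε → 0ℚ Rat.< ε →
    ∃[ N ] (∀ m n → N ℕ.≤ m → N ℕ.≤ n → Rat.∣ s m Rat.- s n ∣ Rat.< ε)

  record ℝ : Set where
    constructor mkℝ
    field
      seq    : ℕ → ℚ
      cauchy : IsCauchy seq
  open ℝ public

  infix 4 _≈_ _≤_ _<_ _#_

  _≈_ : ℝ → ℝ → Set
  x ≈ y = ∀ ε → 0ℚ Rat.< ε → Eventually λ n → Rat.∣ seq x n Rat.- seq y n ∣ Rat.< ε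

  _≤_ : ℝ → ℝ → Set
  x ≤ y = ∀ ε → 0ℚ Rat.< ε → Eventually λ n → seq x n Rat.< seq y n Rat.+ ε

  _<_ : ℝ → ℝ → Set
  x < y = ∃[ c ] (0ℚ Rat.< c × Eventually λ n → seq x n Rat.+ c Rat.≤ seq y n)

  -- Constructive inequality (apartness); classically equivalent to ¬ (x ≈ y).
  _#_ : ℝ → ℝ → Set
  x # y = x < y ⊎ y < x

  private
    ≤₁ : ∀ M N {k} → M ℕ.⊔ N ℕ.≤ k → M ℕ.≤ k
    ≤₁ M N = ℕₚ.≤-trans (ℕₚ.m≤m⊔n M N)

    ≤₂ : ∀ M N {k} → M ℕ.⊔ N ℕ.≤ k → N ℕ.≤ k
    ≤₂ M N = ℕₚ.≤-trans (ℕₚ.m≤n⊔m M N)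

    infixl 5 _&_
    _&_ : ∀ {P Q} → Eventually P → Eventually Q → Eventually λ n → P n × Q n
    (M , p) & (N , q) = M ℕ.⊔ N , λ n M⊔N≤n →
      p n (≤₁ M N M⊔N≤n) , q n (≤₂ M N M⊔N≤n)

    mapᵉ : ∀ {P Q} → (∀ n → P n → Q n) → Eventually P → Eventually Q
    mapᵉ f (N , p) = N , λ n N≤n → f n (p n N≤n)

  ≗⇒≈ : ∀ {x y} → (∀ n → seq x n ≡ seq y n) → x ≈ y
  ≗⇒≈ e ε 0<ε = 0 , λ n _ → subst (Rat._< ε) (sym (dist-zero (e n))) 0<ε

  ≈-refl : ∀ {x} → x ≈ x
  ≈-refl {x} = ≗⇒≈ {x} {x} λ _ → refl

  ≈-sym : ∀ {x y} → x ≈ y → y ≈ x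
  ≈-sym {x} {y} p ε 0<ε =
    mapᵉ (λ n → subst (Rat._< ε) (dist-sym (seq x n) (seq y n))) (p ε 0<ε)

  ≈-trans : ∀ {x y z} → x ≈ y → y ≈ z → x ≈ z
  ≈-trans {x} {y} {z} p q ε 0<ε =
    mapᵉ (λ n (a , b) → dist-trans {seq x n} {seq y n} {seq z n} a b)
      (p _ (0<½* 0<ε) & q _ (0<½* 0<ε))

  bound : ∀ x → ∃[ B ] (0ℚ Rat.< B × Eventually λ n → Rat.∣ seq x n ∣ Rat.≤ B)
  bound x with cauchy x 1ℚ (ℚₚ.positive⁻¹ 1ℚ)
  ... | N , c = 1ℚ Rat.+ Rat.∣ seq x N ∣
              , 0<1+∣ seq x N ∣
              , N , λ n N≤n → ℚₚ.≤-trans (∣a∣≤∣a-b∣+∣b∣ (seq x n) (seq x N))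
                  (ℚₚ.+-monoˡ-≤ Rat.∣ seq x N ∣ (ℚₚ.<⇒≤ (c n N N≤n ℕₚ.≤-refl)))

  fromℚ : ℚ → ℝ
  fromℚ q = mkℝ (λ _ → q) λ ε 0<ε → 0 , λ _ _ _ _ → subst (Rat._< ε) (sym (dist-zero {q} refl)) 0<ε

  0ℝ 1ℝ : ℝ
  0ℝ = fromℚ 0ℚ
  1ℝ = fromℚ 1ℚ

  infixl 6 _+_ _-_
  infixl 7 _*_
  infix  8 -_

  _+_ : ℝ → ℝ → ℝ
  x + y = mkℝ (λ n → seq x n Rat.+ seq y n) cau
    where
    cau : IsCauchy (λ n → seq x n Rat.+ seq y n)
    cau ε 0<ε with cauchy x _ (0<½* 0<ε) | cauchy y _ (0<½* 0<ε)
    ... | M , p | N , q = M ℕ.⊔ N , λ m n a b →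
      dist-+ {seq x m} {seq x n} {seq y m} {seq y n}
        (p m n (≤₁ M N a) (≤₁ M N b))
        (q m n (≤₂ M N a) (≤₂ M N b))

  -_ : ℝ → ℝ
  - x = mkℝ (λ n → Rat.- seq x n) λ ε 0<ε → let N , p = cauchy x ε 0<ε in
    N , λ m n a b → subst (Rat._< ε) (sym (dist-neg (seq x m) (seq x n))) (p m n a b)

  _-_ : ℝ → ℝ → ℝ
  x - y = x + (- y)

  _*_ : ℝ → ℝ → ℝ
  x * y = mkℝ (λ n → seq x n Rat.* seq y n) cau
    where
    cau : IsCauchy (λ n → seq x n Rat.* seq y n)
    cau ε 0<ε =
      let A , 0<A , Nx , x≤A = bound x
          B , 0<B , Ny , y≤B = bound y
          δ₁ , 0<δ₁ , e₁ = *-tolerance {A} {ε} 0<A 0<ε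
          δ₂ , 0<δ₂ , e₂ = *-tolerance {B} {ε} 0<B 0<ε
          M , p = cauchy x δ₂ 0<δ₂
          N , q = cauchy y δ₁ 0<δ₁
      in (Nx ℕ.⊔ Ny) ℕ.⊔ (M ℕ.⊔ N) , λ m n a b →
        dist-* {A} {B} {ε} {δ₁} {δ₂} {seq x m} {seq x n} {seq y m} {seq y n} 0<A 0<B e₁ e₂
          (x≤A m (≤₁ Nx Ny (≤₁ (Nx ℕ.⊔ Ny) (M ℕ.⊔ N) a)))
          (y≤B n (≤₂ Nx Ny (≤₁ (Nx ℕ.⊔ Ny) (M ℕ.⊔ N) b)))
          (p m n (≤₁ M N (≤₂ (Nx ℕ.⊔ Ny) (M ℕ.⊔ N) a)) (≤₁ M N (≤₂ (Nx ℕ.⊔ Ny) (M ℕ.⊔ N) b)))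
          (q m n (≤₂ M N (≤₂ (Nx ℕ.⊔ Ny) (M ℕ.⊔ N) a)) (≤₂ M N (≤₂ (Nx ℕ.⊔ Ny) (M ℕ.⊔ N) b)))

  ∣_∣ : ℝ → ℝ
  ∣ x ∣ = mkℝ (λ n → Rat.∣ seq x n ∣) λ ε 0<ε → let N , p = cauchy x ε 0<ε in
    N , λ m n a b → ℚₚ.≤-<-trans (dist-abs (seq x m) (seq x n)) (p m n a b)

  private
    away : ∀ {x} → x # 0ℝ → ∃[ c ] (0ℚ Rat.< c × Eventually λ n → c Rat.≤ Rat.∣ seq x n ∣)
    away {x} (inj₁ (c , 0<c , e)) = c , 0<c , mapᵉ (λ n → a+c≤0⇒c≤∣a∣ (seq x n) c) e
    away {x} (inj₂ (c , 0<c , e)) = c , 0<c , mapᵉ (λ n 0+c≤x →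
      ℚₚ.≤-trans (subst (Rat._≤ seq x n) (ℚₚ.+-identityˡ c) 0+c≤x) (q≤∣q∣ (seq x n))) e

  -- Termwise reciprocal; the finitely many terms that may vanish are sent to 0.
  inv : ∀ x → x # 0ℝ → ℝ
  inv x x#0 = mkℝ (λ n → recip (seq x n)) cau
    where
    cau : IsCauchy (λ n → recip (seq x n))
    cau ε 0<ε =
      let c , 0<c , M , c≤x = away {x} x#0
          N , p = cauchy x ((c Rat.* c) Rat.* ε) (0<c²ε {c} {ε} 0<c 0<ε)
      in M ℕ.⊔ N , λ m n a b → dist-recip {c} {ε} {seq x m} {seq x n} 0<c
        (c≤x m (≤₁ M N a)) (c≤x n (≤₁ M N b))
        (p m n (≤₂ M N a) (≤₂ M N b))

  inv-inverse : ∀ x x#0 → x * inv x x#0 ≈ 1ℝ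
  inv-inverse x x#0 ε 0<ε =
    let c , 0<c , e = away {x} x#0 in
    mapᵉ (λ n c≤x → subst (Rat._< ε)
      (sym (dist-zero {seq x n Rat.* recip (seq x n)} {1ℚ} (recip-inverse {c} {seq x n} 0<c c≤x))) 0<ε) e

  +-cong : ∀ {x x′ y y′} → x ≈ x′ → y ≈ y′ → x + y ≈ x′ + y′
  +-cong {x} {x′} {y} {y′} p q ε 0<ε =
    mapᵉ (λ n (a , b) → dist-+ {seq x n} {seq x′ n} {seq y n} {seq y′ n} a b)
      (p _ (0<½* 0<ε) & q _ (0<½* 0<ε))

  -‿cong : ∀ {x y} → x ≈ y → - x ≈ - y
  -‿cong {x} {y} p ε 0<ε =
    mapᵉ (λ n → subst (Rat._< ε) (sym (dist-neg (seq x n) (seq y n)))) (p ε 0<ε)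

  *-cong : ∀ {x x′ y y′} → x ≈ x′ → y ≈ y′ → x * y ≈ x′ * y′
  *-cong {x} {x′} {y} {y′} p q ε 0<ε =
    let A , 0<A , x≤A = bound x
        B , 0<B , y≤B = bound y′
        δ₁ , 0<δ₁ , e₁ = *-tolerance {A} {ε} 0<A 0<ε
        δ₂ , 0<δ₂ , e₂ = *-tolerance {B} {ε} 0<B 0<ε
    in mapᵉ (λ n (((a , b) , c) , d) →
           dist-* {A} {B} {ε} {δ₁} {δ₂} {seq x n} {seq x′ n} {seq y n} {seq y′ n} 0<A 0<B e₁ e₂ a b c d)
         (x≤A & y≤B & p δ₂ 0<δ₂ & q δ₁ 0<δ₁)

  ℝ-commutativeRing : CommutativeRing 0ℓ 0ℓ
  ℝ-commutativeRing = record
    { Carrier = ℝ ; _≈_ = _≈_ ; _+_ = _+_ ; _*_ = _*_ ; -_ = -_ ; 0# = 0ℝ ; 1# = 1ℝ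
    ; isCommutativeRing = record
      { isRing = record
        { +-isAbelianGroup = record
          { isGroup = record
            { isMonoid = record
              { isSemigroup = record
                { isMagma = record
                  { isEquivalence = isEq
                  ; ∙-cong = λ {x} {x′} {y} {y′} → +-cong {x} {x′} {y} {y′}
                  }
                ; assoc = λ x y z → ≗⇒≈ {(x + y) + z} {x + (y + z)}
                    λ n → ℚₚ.+-assoc (seq x n) (seq y n) (seq z n)
                }
              ; identity = (λ x → ≗⇒≈ {0ℝ + x} {x} λ n → ℚₚ.+-identityˡ (seq x n))
                         , (λ x → ≗⇒≈ {x + 0ℝ} {x} λ n → ℚₚ.+-identityʳ (seq x n))
              }
            ; inverse = (λ x → ≗⇒≈ {(- x) + x} {0ℝ} λ n → ℚₚ.+-inverseˡ (seq x n))
                      , (λ x → ≗⇒≈ {x + (- x)} {0ℝ} λ n → ℚₚ.+-inverseʳ (seq x n))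
            ; ⁻¹-cong = λ {x} {y} → -‿cong {x} {y}
            }
          ; comm = λ x y → ≗⇒≈ {x + y} {y + x} λ n → ℚₚ.+-comm (seq x n) (seq y n)
          }
        ; *-cong = λ {x} {x′} {y} {y′} → *-cong {x} {x′} {y} {y′}
        ; *-assoc = λ x y z → ≗⇒≈ {(x * y) * z} {x * (y * z)}
            λ n → ℚₚ.*-assoc (seq x n) (seq y n) (seq z n)
        ; *-identity = (λ x → ≗⇒≈ {1ℝ * x} {x} λ n → ℚₚ.*-identityˡ (seq x n))
                     , (λ x → ≗⇒≈ {x * 1ℝ} {x} λ n → ℚₚ.*-identityʳ (seq x n))
        ; distrib = (λ x y z → ≗⇒≈ {x * (y + z)} {x * y + x * z}
                      λ n → ℚₚ.*-distribˡ-+ (seq x n) (seq y n) (seq z n))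
                  , (λ x y z → ≗⇒≈ {(y + z) * x} {y * x + z * x}
                      λ n → ℚₚ.*-distribʳ-+ (seq x n) (seq y n) (seq z n))
        }
      ; *-comm = λ x y → ≗⇒≈ {x * y} {y * x} λ n → ℚₚ.*-comm (seq x n) (seq y n)
      }
    }
    where
    isEq : IsEquivalence _≈_
    isEq = record
      { refl  = λ {x} → ≈-refl {x}
      ; sym   = λ {x} {y} → ≈-sym {x} {y}
      ; trans = λ {x} {y} {z} → ≈-trans {x} {y} {z}
      }

module Central where
  open Rat using (_+_; _*_; -_; _-_; _/_; toℚᵘ)
  open CommutativeRing ℚₚ.+-*-commutativeRing using (semiring)
  open Algebra.Definitions.RawSemiring ℚₚ.+-*-rawSemiring using (_^_; product)
  open Algebra.Properties.Semiring.Sum semiring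

  ι : ℕ → ℚ
  ι n = pos n / 1

  -- x (x + n/2 - 1) (x + n/2 - 2) ⋯ (x - n/2 + 1), the last factor being x + n/2 - (n - 1).
  centralFactorial : ℕ → ℚ → ℚ
  centralFactorial zero    x = 1ℚ
  centralFactorial (suc m) x = x * product {m} λ i → (x + pos (suc m) / 2) - ι (suc (toℕ i))

  -- T n k = (1/k!) Σ_j (-1)^j (k choose j) (k/2 - j)^n, the k-th central difference
  -- of x ^ n at 0 divided by k!. See T-expansion for the defining property.
  T : ℕ → ℕ → ℚ
  T n k = (pos 1 / k !) {{ℕₚ._!≢0 k}} *
    ∑[ j ≤ k ] (((- 1ℚ) ^ toℕ j * ι (k C toℕ j)) * (pos k / 2 - ι (toℕ j)) ^ n)

  module Expansion where
    open ≡-Reasoning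
    open +-*-Solver

    ι-suc : ∀ n → ι (suc n) ≡ 1ℚ + ι n
    ι-suc n = ℚₚ.toℚᵘ-injective (begin-≃ )
      where
      begin-≃ : toℚᵘ (ι (suc n)) ℚᵘ.≃ toℚᵘ (1ℚ + ι n)
      begin-≃ = ℚᵘₚ.≃-trans (ℚₚ.toℚᵘ-fromℚᵘ (ℚᵘ.mkℚᵘ (pos (suc n)) 0))
        (ℚᵘₚ.≃-trans (ℚᵘ.*≡* (lem (pos n)))
        (ℚᵘₚ.≃-sym (ℚᵘₚ.≃-trans (ℚₚ.toℚᵘ-homo-+ 1ℚ (ι n))
          (ℚᵘₚ.+-congʳ (toℚᵘ 1ℚ) (ℚₚ.toℚᵘ-fromℚᵘ (ℚᵘ.mkℚᵘ (pos n) 0))))))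
        where
        lem : ∀ m → (pos 1 ℤ.+ m) ℤ.* (pos 1 ℤ.* pos 1) ≡ (pos 1 ℤ.* pos 1 ℤ.+ m ℤ.* pos 1) ℤ.* pos 1
        lem = ℤSolver.solve-∀

    half : ∀ n → pos n / 2 ≡ ½ * ι n
    half n = ℚₚ.toℚᵘ-injective
        (ℚᵘₚ.≃-trans (ℚₚ.toℚᵘ-fromℚᵘ (ℚᵘ.mkℚᵘ (pos n) 1))
        (ℚᵘₚ.≃-trans (ℚᵘ.*≡* (lem (pos n)))
        (ℚᵘₚ.≃-sym (ℚᵘₚ.≃-trans (ℚₚ.toℚᵘ-homo-* ½ (ι n))
          (ℚᵘₚ.*-congˡ {toℚᵘ ½} (ℚₚ.toℚᵘ-fromℚᵘ (ℚᵘ.mkℚᵘ (pos n) 0)))))))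
        where
        lem : ∀ m → m ℤ.* (pos 2 ℤ.* pos 1) ≡ (pos 1 ℤ.* m) ℤ.* pos 2
        lem = ℤSolver.solve-∀

    ι-+ : ∀ m n → ι (m ℕ.+ n) ≡ ι m + ι n
    ι-+ zero n = sym (ℚₚ.+-identityˡ (ι n))
    ι-+ (suc m) n = begin
      ι (suc (m ℕ.+ n))   ≡⟨ ι-suc (m ℕ.+ n) ⟩
      1ℚ + ι (m ℕ.+ n)    ≡⟨ cong (1ℚ +_) (ι-+ m n) ⟩
      1ℚ + (ι m + ι n)    ≡⟨ ℚₚ.+-assoc 1ℚ (ι m) (ι n) ⟨
      (1ℚ + ι m) + ι n    ≡⟨ cong (_+ ι n) (ι-suc m) ⟨
      ι (suc m) + ι n     ∎

    ι-* : ∀ m n → ι (m ℕ.* n) ≡ ι m * ι n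
    ι-* zero n = sym (ℚₚ.*-zeroˡ (ι n))
    ι-* (suc m) n = begin
      ι (n ℕ.+ m ℕ.* n)     ≡⟨ ι-+ n (m ℕ.* n) ⟩
      ι n + ι (m ℕ.* n)     ≡⟨ cong (ι n +_) (ι-* m n) ⟩
      ι n + ι m * ι n       ≡⟨ solve 2 (λ m n → n :+ m :* n := (con 1ℚ :+ m) :* n) refl (ι m) (ι n) ⟩
      (1ℚ + ι m) * ι n      ≡⟨ cong (_* ι n) (ι-suc m) ⟨
      ι (suc m) * ι n       ∎

    1/n*n : ∀ n .{{_ : ℕ.NonZero n}} → (pos 1 / n) * ι n ≡ 1ℚ
    1/n*n n@(suc m) = ℚₚ.toℚᵘ-injective
        (ℚᵘₚ.≃-trans (ℚₚ.toℚᵘ-homo-* (pos 1 / n) (ι n))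
        (ℚᵘₚ.≃-trans (ℚᵘₚ.*-cong (ℚₚ.toℚᵘ-fromℚᵘ (ℚᵘ.mkℚᵘ (pos 1) m)) (ℚₚ.toℚᵘ-fromℚᵘ (ℚᵘ.mkℚᵘ (pos n) 0)))
          (ℚᵘ.*≡* (lem (pos n)))))
        where
        lem : ∀ m → (pos 1 ℤ.* m) ℤ.* pos 1 ≡ pos 1 ℤ.* (m ℤ.* pos 1)
        lem = ℤSolver.solve-∀

    Σ< : ℕ → (ℕ → ℚ) → ℚ
    Σ< n f = sum {n} (λ i → f (toℕ i))

    Σ-cong : ∀ n {f g} → (∀ i → f i ≡ g i) → Σ< n f ≡ Σ< n g
    Σ-cong n e = sum-cong-≗ {n} (λ i → e (toℕ i))

    Σ-+ : ∀ n f g → Σ< n (λ i → f i + g i) ≡ Σ< n f + Σ< n g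
    Σ-+ n f g = ∑-distrib-+ {n} (λ i → f (toℕ i)) (λ i → g (toℕ i))

    Σ-* : ∀ n c f → Σ< n (λ i → c * f i) ≡ c * Σ< n f
    Σ-* n c f = sym (*-distribˡ-sum {n} c (λ i → f (toℕ i)))

    Σ-last : ∀ n f → Σ< (suc n) f ≡ Σ< n f + f n
    Σ-last zero f = ℚₚ.+-comm (f 0) 0ℚ
    Σ-last (suc n) f = trans (cong (f 0 +_) (Σ-last n (λ i → f (suc i))))
      (sym (ℚₚ.+-assoc (f 0) (Σ< n (λ i → f (suc i))) (f (suc n))))

    Δ : (ℚ → ℚ) → ℚ → ℚ
    Δ f x = f (x + ½) - f (x - ½)

    Δ^ : ℕ → (ℚ → ℚ) → ℚ → ℚ
    Δ^ zero    f = f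
    Δ^ (suc k) f = Δ^ k (Δ f)

    Δ^-cong : ∀ k {f g} → (∀ x → f x ≡ g x) → ∀ x → Δ^ k f x ≡ Δ^ k g x
    Δ^-cong zero e = e
    Δ^-cong (suc k) e = Δ^-cong k λ x → cong₂ _-_ (e (x + ½)) (e (x - ½))

    Δ^-* : ∀ k c f x → Δ^ k (λ y → c * f y) x ≡ c * Δ^ k f x
    Δ^-* zero c f x = refl
    Δ^-* (suc k) c f x = trans
      (Δ^-cong k (λ y → solve 3 (λ c p q → c :* p :- c :* q := c :* (p :- q)) refl c (f (y + ½)) (f (y - ½))) x)
      (Δ^-* k c (Δ f) x)

    Δ^-+ : ∀ k f g x → Δ^ k (λ y → f y + g y) x ≡ Δ^ k f x + Δ^ k g x
    Δ^-+ zero f g x = refl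
    Δ^-+ (suc k) f g x = trans
      (Δ^-cong k (λ y → solve 4 (λ p q r s → (p :+ q) :- (r :+ s) := (p :- r) :+ (q :- s)) refl
        (f (y + ½)) (g (y + ½)) (f (y - ½)) (g (y - ½))) x)
      (Δ^-+ k (Δ f) (Δ g) x)

    Δ^-0 : ∀ k x → Δ^ k (λ _ → 0ℚ) x ≡ 0ℚ
    Δ^-0 zero x = refl
    Δ^-0 (suc k) x = Δ^-0 k x

    Δ^-Σ : ∀ k n (f : ℕ → ℚ → ℚ) x → Δ^ k (λ y → Σ< n (λ i → f i y)) x ≡ Σ< n (λ i → Δ^ k (f i) x)
    Δ^-Σ k zero f x = Δ^-0 k x
    Δ^-Σ k (suc n) f x = trans (Δ^-+ k (f 0) (λ y → Σ< n (λ i → f (suc i) y)) x)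
      (cong (Δ^ k (f 0) x +_) (Δ^-Σ k n (λ i → f (suc i)) x))

    sgn : ℕ → ℕ → ℚ
    sgn k j = (- 1ℚ) ^ j * ι (k C j)

    sgn-0 : ∀ k → sgn k 0 ≡ 1ℚ
    sgn-0 k = refl

    sgn-k<j : ∀ k → sgn k (suc k) ≡ 0ℚ
    sgn-k<j k = trans (cong (λ t → (- 1ℚ) ^ suc k * ι t) (k>n⇒nCk≡0 {k} {suc k} ℕₚ.≤-refl)) (ℚₚ.*-zeroʳ ((- 1ℚ) ^ suc k))

    sgn-suc : ∀ k j → sgn (suc k) (suc j) ≡ sgn k (suc j) - sgn k j
    sgn-suc k j = trans (cong (λ t → (- 1ℚ) ^ suc j * ι t) (sym (nCk+nC[k+1]≡[n+1]C[k+1] k j)))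
      (trans (cong ((- 1ℚ) ^ suc j *_) (ι-+ (k C j) (k C suc j)))
        (solve 3 (λ s a b → (:- con 1ℚ :* s) :* (a :+ b) := (:- con 1ℚ :* s) :* b :- s :* a) refl
          ((- 1ℚ) ^ j) (ι (k C j)) (ι (k C suc j))))

    Δ^-explicit : ∀ k f x → Δ^ k f x ≡ Σ< (suc k) (λ j → sgn k j * f ((x + pos k / 2) - ι j))
    Δ^-explicit zero f x = trans (cong f (solve 1 (λ x → x := (x :+ con 0ℚ) :- con 0ℚ) refl x))
      (solve 1 (λ y → y := con 1ℚ :* y :+ con 0ℚ) refl (f ((x + 0ℚ) - 0ℚ)))
    Δ^-explicit (suc k) f x = begin
      Δ^ k (Δ f) x
        ≡⟨ Δ^-explicit k (Δ f) x ⟩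
      Σ< (suc k) (λ j → sgn k j * Δ f ((x + pos k / 2) - ι j))
        ≡⟨ Σ-cong (suc k) (λ j → trans (cong (sgn k j *_) (cong₂ _-_ (cong f (e₁ j)) (cong f (e₂ j))))
             (solve 3 (λ s p q → s :* (p :- q) := s :* p :+ :- con 1ℚ :* (s :* q)) refl (sgn k j) (F j) (F (suc j)))) ⟩
      Σ< (suc k) (λ j → sgn k j * F j + (- 1ℚ) * (sgn k j * F (suc j)))
        ≡⟨ Σ-+ (suc k) (λ j → sgn k j * F j) (λ j → (- 1ℚ) * (sgn k j * F (suc j))) ⟩
      Σ< (suc k) (λ j → sgn k j * F j) + Σ< (suc k) (λ j → (- 1ℚ) * (sgn k j * F (suc j)))
        ≡⟨ cong (_+ Σ< (suc k) (λ j → (- 1ℚ) * (sgn k j * F (suc j)))) ext ⟩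
      (sgn k 0 * F 0 + Σ< (suc k) (λ j → sgn k (suc j) * F (suc j))) + Σ< (suc k) (λ j → (- 1ℚ) * (sgn k j * F (suc j)))
        ≡⟨ ℚₚ.+-assoc (sgn k 0 * F 0) (Σ< (suc k) (λ j → sgn k (suc j) * F (suc j))) (Σ< (suc k) (λ j → (- 1ℚ) * (sgn k j * F (suc j)))) ⟩
      sgn k 0 * F 0 + (Σ< (suc k) (λ j → sgn k (suc j) * F (suc j)) + Σ< (suc k) (λ j → (- 1ℚ) * (sgn k j * F (suc j))))
        ≡⟨ cong (sgn k 0 * F 0 +_) (Σ-+ (suc k) (λ j → sgn k (suc j) * F (suc j)) (λ j → (- 1ℚ) * (sgn k j * F (suc j)))) ⟨
      sgn k 0 * F 0 + Σ< (suc k) (λ j → sgn k (suc j) * F (suc j) + (- 1ℚ) * (sgn k j * F (suc j)))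
        ≡⟨ cong (sgn k 0 * F 0 +_) (Σ-cong (suc k) (λ j → trans
             (solve 3 (λ s t p → s :* p :+ :- con 1ℚ :* (t :* p) := (s :- t) :* p) refl (sgn k (suc j)) (sgn k j) (F (suc j)))
             (cong (_* F (suc j)) (sym (sgn-suc k j))))) ⟩
      sgn (suc k) 0 * F 0 + Σ< (suc k) (λ j → sgn (suc k) (suc j) * F (suc j)) ∎
      where
      F : ℕ → ℚ
      F j = f ((x + pos (suc k) / 2) - ι j)
      h : pos (suc k) / 2 ≡ ½ + pos k / 2
      h = trans (half (suc k)) (trans (cong (½ *_) (ι-suc k))
        (trans (solve 1 (λ i → con ½ :* (con 1ℚ :+ i) := con ½ :+ con ½ :* i) refl (ι k)) (cong (½ +_) (sym (half k)))))
      e₁ : ∀ j → ((x + pos k / 2) - ι j) + ½ ≡ (x + pos (suc k) / 2) - ι j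
      e₁ j = trans (solve 3 (λ x h i → ((x :+ h) :- i) :+ con ½ := (x :+ (con ½ :+ h)) :- i) refl x (pos k / 2) (ι j))
        (cong (λ t → (x + t) - ι j) (sym h))
      e₂ : ∀ j → ((x + pos k / 2) - ι j) - ½ ≡ (x + pos (suc k) / 2) - ι (suc j)
      e₂ j = trans (solve 3 (λ x h i → ((x :+ h) :- i) :- con ½ := (x :+ (con ½ :+ h)) :- (con 1ℚ :+ i)) refl x (pos k / 2) (ι j))
        (cong₂ (λ s t → (x + s) - t) (sym h) (sym (ι-suc j)))
      ext : Σ< (suc k) (λ j → sgn k j * F j) ≡ Σ< (suc (suc k)) (λ j → sgn k j * F j)
      ext = sym (trans (Σ-last (suc k) (λ j → sgn k j * F j))
        (trans (cong (Σ< (suc k) (λ j → sgn k j * F j) +_) (trans (cong (_* F (suc k)) (sgn-k<j k)) (ℚₚ.*-zeroˡ (F (suc k)))))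
          (ℚₚ.+-identityʳ (Σ< (suc k) (λ j → sgn k j * F j)))))

    k!T : ∀ n k → ι (k !) * T n k ≡ Δ^ k (_^ n) 0ℚ
    k!T n k = begin
      ι (k !) * (1/k! * A)    ≡⟨ solve 3 (λ p q a → p :* (q :* a) := (q :* p) :* a) refl (ι (k !)) 1/k! A ⟩
      (1/k! * ι (k !)) * A    ≡⟨ cong (_* A) (1/n*n (k !) {{ℕₚ._!≢0 k}}) ⟩
      1ℚ * A                  ≡⟨ ℚₚ.*-identityˡ A ⟩
      A                       ≡⟨ Σ-cong (suc k) (λ j → cong (λ t → sgn k j * (t - ι j) ^ n) (sym (ℚₚ.+-identityˡ (pos k / 2)))) ⟩
      Σ< (suc k) (λ j → sgn k j * ((0ℚ + pos k / 2) - ι j) ^ n) ≡⟨ Δ^-explicit k (_^ n) 0ℚ ⟨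
      Δ^ k (_^ n) 0ℚ          ∎
      where
      1/k! = (pos 1 / k !) {{ℕₚ._!≢0 k}}
      A = Σ< (suc k) (λ j → sgn k j * (pos k / 2 - ι j) ^ n)

    P : ℕ → ℚ → ℚ
    P m y = product {m} λ i → y - ι (suc (toℕ i))

    P-cong : ∀ m (f g : ℕ → ℚ) → (∀ i → f i ≡ g i) → product {m} (λ i → f (toℕ i)) ≡ product {m} (λ i → g (toℕ i))
    P-cong zero f g e = refl
    P-cong (suc m) f g e = cong₂ _*_ (e 0) (P-cong m (λ i → f (suc i)) (λ i → g (suc i)) (λ i → e (suc i)))

    P-first : ∀ m y → P (suc m) (1ℚ + y) ≡ y * P m y
    P-first m y = cong₂ _*_ (solve 1 (λ y → (con 1ℚ :+ y) :- con 1ℚ := y) refl y)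
      (P-cong m _ _ λ i → trans (cong (λ t → (1ℚ + y) - t) (ι-suc (suc i)))
        (solve 2 (λ y i → (con 1ℚ :+ y) :- (con 1ℚ :+ i) := y :- i) refl y (ι (suc i))))

    prod-last : ∀ m (f : ℕ → ℚ) → product {suc m} (λ i → f (toℕ i)) ≡ product {m} (λ i → f (toℕ i)) * f m
    prod-last zero f = ℚₚ.*-comm (f 0) 1ℚ
    prod-last (suc m) f = trans (cong (f 0 *_) (prod-last m (λ i → f (suc i))))
      (sym (ℚₚ.*-assoc (f 0) (product {m} (λ i → f (suc (toℕ i)))) (f (suc m))))

    P-last : ∀ m y → P (suc m) y ≡ P m y * (y - ι (suc m))
    P-last m y = prod-last m (λ i → y - ι (suc i))

    cf = centralFactorial

    cf-step : ∀ k x → cf (2 ℕ.+ k) x ≡ cf k x * (x * x - (½ * ι k) * (½ * ι k))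
    cf-step zero x = solve 1 (λ x → x :* (((x :+ con 1ℚ) :- con 1ℚ) :* con 1ℚ) := con 1ℚ :* (x :* x :- (con ½ :* con 0ℚ) :* (con ½ :* con 0ℚ))) refl x
    cf-step (suc k) x = begin
      x * P (2 ℕ.+ k) (x + pos (3 ℕ.+ k) / 2)
        ≡⟨ cong (λ t → x * P (2 ℕ.+ k) t) e ⟩
      x * P (2 ℕ.+ k) (1ℚ + (x + h))
        ≡⟨ cong (x *_) (P-first (suc k) (x + h)) ⟩
      x * ((x + h) * P (suc k) (x + h))
        ≡⟨ cong (λ t → x * ((x + h) * t)) (P-last k (x + h)) ⟩
      x * ((x + h) * (P k (x + h) * ((x + h) - ι (suc k))))
        ≡⟨ cong (λ t → x * ((x + t) * (P k (x + h) * ((x + t) - ι (suc k))))) (half (suc k)) ⟩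
      x * ((x + ½ * ι (suc k)) * (P k (x + h) * ((x + ½ * ι (suc k)) - ι (suc k))))
        ≡⟨ solve 3 (λ x p i → x :* ((x :+ con ½ :* i) :* (p :* ((x :+ con ½ :* i) :- i)))
              := (x :* p) :* (x :* x :- (con ½ :* i) :* (con ½ :* i))) refl x (P k (x + h)) (ι (suc k)) ⟩
      (x * P k (x + h)) * (x * x - (½ * ι (suc k)) * (½ * ι (suc k))) ∎
      where
      h = pos (suc k) / 2
      e : x + pos (3 ℕ.+ k) / 2 ≡ 1ℚ + (x + h)
      e = trans (cong (x +_) (trans (half (3 ℕ.+ k)) (cong (½ *_) (trans (ι-suc (2 ℕ.+ k)) (cong (1ℚ +_) (ι-suc (suc k)))))))
        (trans (solve 2 (λ x i → x :+ con ½ :* (con 1ℚ :+ (con 1ℚ :+ i)) := con 1ℚ :+ (x :+ con ½ :* i)) refl x (ι (suc k)))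
          (cong (λ t → 1ℚ + (x + t)) (sym (half (suc k)))))

    Δ-cf : ∀ k x → Δ (cf (suc k)) x ≡ ι (suc k) * cf k x
    Δ-cf zero x = solve 1 (λ x → (x :+ con ½) :* con 1ℚ :- (x :- con ½) :* con 1ℚ := con 1ℚ :* con 1ℚ) refl x
    Δ-cf (suc m) x = begin
      (x + ½) * P (suc m) ((x + ½) + pos (2 ℕ.+ m) / 2) - (x - ½) * P (suc m) ((x - ½) + pos (2 ℕ.+ m) / 2)
        ≡⟨ cong₂ (λ s t → (x + ½) * P (suc m) s - (x - ½) * P (suc m) t) e₁ e₂ ⟩
      (x + ½) * P (suc m) (1ℚ + (x + h)) - (x - ½) * P (suc m) (x + h)
        ≡⟨ cong₂ (λ s t → (x + ½) * s - (x - ½) * t) (P-first m (x + h)) (P-last m (x + h)) ⟩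
      (x + ½) * ((x + h) * Q) - (x - ½) * (Q * ((x + h) - ι (suc m)))
        ≡⟨ cong (λ t → (x + ½) * ((x + t) * Q) - (x - ½) * (Q * ((x + t) - ι (suc m)))) (half (suc m)) ⟩
      (x + ½) * ((x + ½ * ι (suc m)) * Q) - (x - ½) * (Q * ((x + ½ * ι (suc m)) - ι (suc m)))
        ≡⟨ solve 3 (λ x q i → (x :+ con ½) :* ((x :+ con ½ :* i) :* q) :- (x :- con ½) :* (q :* ((x :+ con ½ :* i) :- i))
             := (con 1ℚ :+ i) :* (x :* q)) refl x Q (ι (suc m)) ⟩
      (1ℚ + ι (suc m)) * (x * Q)
        ≡⟨ cong (_* (x * Q)) (ι-suc (suc m)) ⟨
      ι (2 ℕ.+ m) * (x * Q) ∎
      where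
      h = pos (suc m) / 2
      Q = P m (x + h)
      e₀ : pos (2 ℕ.+ m) / 2 ≡ ½ + h
      e₀ = trans (half (2 ℕ.+ m)) (trans (cong (½ *_) (ι-suc (suc m)))
        (trans (solve 1 (λ i → con ½ :* (con 1ℚ :+ i) := con ½ :+ con ½ :* i) refl (ι (suc m))) (cong (½ +_) (sym (half (suc m))))))
      e₁ : (x + ½) + pos (2 ℕ.+ m) / 2 ≡ 1ℚ + (x + h)
      e₁ = trans (cong ((x + ½) +_) e₀) (solve 2 (λ x h → (x :+ con ½) :+ (con ½ :+ h) := con 1ℚ :+ (x :+ h)) refl x h)
      e₂ : (x - ½) + pos (2 ℕ.+ m) / 2 ≡ x + h
      e₂ = trans (cong ((x - ½) +_) e₀) (solve 2 (λ x h → (x :- con ½) :+ (con ½ :+ h) := x :+ h) refl x h)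

    δ : ℕ → ℕ → ℚ
    δ zero    zero    = 1ℚ
    δ zero    (suc _) = 0ℚ
    δ (suc _) zero    = 0ℚ
    δ (suc k) (suc i) = δ k i

    Δ^-cf : ∀ k i → Δ^ k (cf i) 0ℚ ≡ ι (k !) * δ k i
    Δ^-cf zero zero = refl
    Δ^-cf zero (suc i) = trans (ℚₚ.*-zeroˡ (P i (0ℚ + pos (suc i) / 2))) refl
    Δ^-cf (suc k) zero = trans (Δ^-0 k 0ℚ) (sym (ℚₚ.*-zeroʳ (ι (suc k !))))
    Δ^-cf (suc k) (suc i) = begin
      Δ^ k (Δ (cf (suc i))) 0ℚ                ≡⟨ Δ^-cong k (Δ-cf i) 0ℚ ⟩
      Δ^ k (λ x → ι (suc i) * cf i x) 0ℚ      ≡⟨ Δ^-* k (ι (suc i)) (cf i) 0ℚ ⟩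
      ι (suc i) * Δ^ k (cf i) 0ℚ              ≡⟨ cong (ι (suc i) *_) (Δ^-cf k i) ⟩
      ι (suc i) * (ι (k !) * δ k i)           ≡⟨ swap k i ⟩
      ι (suc k !) * δ k i                     ∎
      where
      δ-swap : ∀ k i (f : ℕ → ℚ) → f i * δ k i ≡ f k * δ k i
      δ-swap zero zero f = refl
      δ-swap zero (suc i) f = trans (ℚₚ.*-zeroʳ (f (suc i))) (sym (ℚₚ.*-zeroʳ (f 0)))
      δ-swap (suc k) zero f = trans (ℚₚ.*-zeroʳ (f 0)) (sym (ℚₚ.*-zeroʳ (f (suc k))))
      δ-swap (suc k) (suc i) f = δ-swap k i (λ j → f (suc j))
      swap : ∀ k i → ι (suc i) * (ι (k !) * δ k i) ≡ ι (suc k !) * δ k i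
      swap k i = begin
        ι (suc i) * (ι (k !) * δ k i)   ≡⟨ solve 3 (λ a b d → a :* (b :* d) := b :* (a :* d)) refl (ι (suc i)) (ι (k !)) (δ k i) ⟩
        ι (k !) * (ι (suc i) * δ k i)   ≡⟨ cong (ι (k !) *_) (δ-swap k i (λ j → ι (suc j))) ⟩
        ι (k !) * (ι (suc k) * δ k i)   ≡⟨ solve 3 (λ a b d → b :* (a :* d) := (a :* b) :* d) refl (ι (suc k)) (ι (k !)) (δ k i) ⟩
        (ι (suc k) * ι (k !)) * δ k i   ≡⟨ cong (_* δ k i) (ι-* (suc k) (k !)) ⟨
        ι (suc k !) * δ k i             ∎

    Σ-zero : ∀ n (f : ℕ → ℚ) → (∀ i → f i ≡ 0ℚ) → Σ< n f ≡ 0ℚ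
    Σ-zero zero f e = refl
    Σ-zero (suc n) f e = trans (cong₂ _+_ (e 0) (Σ-zero n (λ i → f (suc i)) (λ i → e (suc i)))) refl

    Σ-δ : ∀ k n (f : ℕ → ℚ) → k ℕ.< n → Σ< n (λ i → f i * δ k i) ≡ f k
    Σ-δ zero (suc n) f _ = trans (cong (f 0 * 1ℚ +_) (Σ-zero n _ (λ i → ℚₚ.*-zeroʳ (f (suc i)))))
      (solve 1 (λ a → a :* con 1ℚ :+ con 0ℚ := a) refl (f 0))
    Σ-δ (suc k) (suc n) f (ℕ.s≤s k<n) = trans (cong₂ _+_ (ℚₚ.*-zeroʳ (f 0)) (Σ-δ k n (λ i → f (suc i)) k<n))
      (ℚₚ.+-identityˡ (f (suc k)))

    S : ℕ → ℕ → ℚ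
    S zero    zero    = 1ℚ
    S zero    (suc k) = 0ℚ
    S (suc zero) (suc zero) = 1ℚ
    S (suc zero) zero = 0ℚ
    S (suc zero) (suc (suc k)) = 0ℚ
    S (suc (suc n)) zero    = 0ℚ
    S (suc (suc n)) (suc zero) = ((½ * ι 1) * (½ * ι 1)) * S n 1
    S (suc (suc n)) (suc (suc k)) = ((½ * ι (2 ℕ.+ k)) * (½ * ι (2 ℕ.+ k))) * S n (2 ℕ.+ k) + S n k

    S-0 : ∀ n k → n ℕ.< k → S n k ≡ 0ℚ
    S-0 zero (suc k) _ = refl
    S-0 (suc zero) (suc zero) (ℕ.s≤s ())
    S-0 (suc zero) (suc (suc k)) _ = refl
    S-0 (suc (suc n)) (suc zero) (ℕ.s≤s ())
    S-0 (suc (suc n)) (suc (suc k)) (ℕ.s≤s (ℕ.s≤s n<k)) = trans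
      (cong₂ (λ s t → c * s + t) (S-0 n (2 ℕ.+ k) (ℕₚ.m≤n⇒m≤1+n (ℕₚ.m≤n⇒m≤1+n n<k))) (S-0 n k n<k))
      (solve 1 (λ c → c :* con 0ℚ :+ con 0ℚ := con 0ℚ) refl c)
      where c = (½ * ι (2 ℕ.+ k)) * (½ * ι (2 ℕ.+ k))

    sq : ℕ → ℚ
    sq k = (½ * ι k) * (½ * ι k)

    S-expansion : ∀ n x → x ^ n ≡ Σ< (suc n) (λ k → S n k * cf k x)
    S-expansion zero x = refl
    S-expansion (suc zero) x = solve 1 (λ x → x :* con 1ℚ := con 0ℚ :* con 1ℚ :+ (con 1ℚ :* (x :* con 1ℚ) :+ con 0ℚ)) refl x
    S-expansion (suc (suc n)) x = begin
      x * (x * x ^ n)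
        ≡⟨ solve 2 (λ x p → x :* (x :* p) := (x :* x) :* p) refl x (x ^ n) ⟩
      (x * x) * x ^ n
        ≡⟨ cong ((x * x) *_) (S-expansion n x) ⟩
      (x * x) * Σ< (suc n) (λ k → S n k * cf k x)
        ≡⟨ Σ-* (suc n) (x * x) (λ k → S n k * cf k x) ⟨
      Σ< (suc n) (λ k → (x * x) * (S n k * cf k x))
        ≡⟨ Σ-cong (suc n) (λ k → trans
             (solve 4 (λ x s c q → (x :* x) :* (s :* c) := q :* s :* c :+ s :* (c :* (x :* x :- q))) refl x (S n k) (cf k x) (sq k))
             (cong (λ t → sq k * S n k * cf k x + S n k * t) (sym (cf-step k x)))) ⟩
      Σ< (suc n) (λ k → A k + B k)
        ≡⟨ Σ-+ (suc n) A B ⟩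
      Σ< (suc n) A + Σ< (suc n) B
        ≡⟨ cong (_+ Σ< (suc n) B) ext ⟩
      (A 0 + (A 1 + Σ< (suc n) (λ k → A (2 ℕ.+ k)))) + Σ< (suc n) B
        ≡⟨ cong (λ t → (t + (A 1 + Σ< (suc n) (λ k → A (2 ℕ.+ k)))) + Σ< (suc n) B)
             (solve 1 (λ s → (con ½ :* con 0ℚ) :* (con ½ :* con 0ℚ) :* s :* con 1ℚ := con 0ℚ :* con 1ℚ) refl (S n 0)) ⟩
      (0ℚ * 1ℚ + (A 1 + Σ< (suc n) (λ k → A (2 ℕ.+ k)))) + Σ< (suc n) B
        ≡⟨ solve 4 (λ z a s b → (z :+ (a :+ s)) :+ b := z :+ (a :+ (s :+ b))) refl (0ℚ * 1ℚ) (A 1) (Σ< (suc n) (λ k → A (2 ℕ.+ k))) (Σ< (suc n) B) ⟩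
      0ℚ * 1ℚ + (A 1 + (Σ< (suc n) (λ k → A (2 ℕ.+ k)) + Σ< (suc n) B))
        ≡⟨ cong (λ t → 0ℚ * 1ℚ + (A 1 + t)) (trans (sym (Σ-+ (suc n) (λ k → A (2 ℕ.+ k)) B))
             (Σ-cong (suc n) (λ k → sym (ℚₚ.*-distribʳ-+ (cf (2 ℕ.+ k) x) (sq (2 ℕ.+ k) * S n (2 ℕ.+ k)) (S n k))))) ⟩
      Σ< (3 ℕ.+ n) (λ k → S (2 ℕ.+ n) k * cf k x) ∎
      where
      A B : ℕ → ℚ
      A k = sq k * S n k * cf k x
      B k = S n k * cf (2 ℕ.+ k) x
      A-0 : ∀ k → n ℕ.< k → A k ≡ 0ℚ
      A-0 k n<k = trans (cong (λ t → sq k * t * cf k x) (S-0 n k n<k))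
        (solve 2 (λ q c → q :* con 0ℚ :* c := con 0ℚ) refl (sq k) (cf k x))
      pad : ∀ m → A m ≡ 0ℚ → Σ< m A ≡ Σ< (suc m) A
      pad m e = sym (trans (Σ-last m A) (trans (cong (Σ< m A +_) e) (ℚₚ.+-identityʳ (Σ< m A))))
      ext : Σ< (suc n) A ≡ Σ< (3 ℕ.+ n) A
      ext = trans (pad (suc n) (A-0 (suc n) ℕₚ.≤-refl)) (pad (2 ℕ.+ n) (A-0 (2 ℕ.+ n) (ℕₚ.m≤n⇒m≤1+n ℕₚ.≤-refl)))

    T≡S : ∀ n k → k ℕ.< suc n → T n k ≡ S n k
    T≡S n k k≤n = begin
      T n k                       ≡⟨ cancel (T n k) ⟨
      1/k! * (ι (k !) * T n k)    ≡⟨ cong (1/k! *_) eq ⟩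
      1/k! * (ι (k !) * S n k)    ≡⟨ cancel (S n k) ⟩
      S n k                       ∎
      where
      1/k! = (pos 1 / k !) {{ℕₚ._!≢0 k}}
      cancel : ∀ t → 1/k! * (ι (k !) * t) ≡ t
      cancel t = trans (sym (ℚₚ.*-assoc 1/k! (ι (k !)) t))
        (trans (cong (_* t) (1/n*n (k !) {{ℕₚ._!≢0 k}})) (ℚₚ.*-identityˡ t))
      eq : ι (k !) * T n k ≡ ι (k !) * S n k
      eq = begin
        ι (k !) * T n k                                           ≡⟨ k!T n k ⟩
        Δ^ k (_^ n) 0ℚ                                            ≡⟨ Δ^-cong k (S-expansion n) 0ℚ ⟩
        Δ^ k (λ x → Σ< (suc n) (λ i → S n i * cf i x)) 0ℚ         ≡⟨ Δ^-Σ k (suc n) (λ i x → S n i * cf i x) 0ℚ ⟩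
        Σ< (suc n) (λ i → Δ^ k (λ x → S n i * cf i x) 0ℚ)
          ≡⟨ Σ-cong (suc n) (λ i → trans (Δ^-* k (S n i) (cf i) 0ℚ) (trans (cong (S n i *_) (Δ^-cf k i))
               (solve 3 (λ s f d → s :* (f :* d) := (f :* s) :* d) refl (S n i) (ι (k !)) (δ k i)))) ⟩
        Σ< (suc n) (λ i → (ι (k !) * S n i) * δ k i)              ≡⟨ Σ-δ k (suc n) (λ i → ι (k !) * S n i) k≤n ⟩
        ι (k !) * S n k                                           ∎

  open Expansion

  -- The T n k are the coefficients of x ^ n in the basis of central factorials.
  T-expansion : ∀ n x → x ^ n ≡ ∑[ k ≤ n ] (T n (toℕ k) * centralFactorial (toℕ k) x)
  T-expansion n x = trans (S-expansion n x)
    (sum-cong-≗ λ k → cong (_* centralFactorial (toℕ k) x) (sym (T≡S n (toℕ k) (toℕ<n k))))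

open Real public
open Central public using (ι; centralFactorial; T; T-expansion)

open CommutativeRing ℝ-commutativeRing using () renaming (semiring to ℝ-semiring)
open Algebra.Definitions.RawSemiring (Semiring.rawSemiring ℝ-semiring) public
  using (_^_; product)
open Algebra.Properties.Semiring.Sum ℝ-semiring public using (sum⁺-syntax)

-- Division-free form of the ε-δ definition: f y = f x + L (y - x) + o(y - x).
HasDerivativeAt : (ℝ → ℝ) → ℝ → ℝ → Set
HasDerivativeAt f x L = ∀ ε → 0ℝ < ε → ∃[ δ ] (0ℝ < δ ×
  (∀ y → ∣ y - x ∣ < δ → ∣ (f y - f x) - L * (y - x) ∣ ≤ ε * ∣ y - x ∣))

-- HasNthDerivativeAt r f x L says f⁽ʳ⁾(x) = L, where f⁽ʳ⁺¹⁾ = (f′)⁽ʳ⁾ and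
-- f′ is required to exist on the whole real line.
HasNthDerivativeAt : ℕ → (ℝ → ℝ) → ℝ → ℝ → Set
HasNthDerivativeAt zero    f x L = f x ≈ L
HasNthDerivativeAt (suc r) f x L =
  ∃[ f′ ] ((∀ y → HasDerivativeAt f y (f′ y)) × HasNthDerivativeAt r f′ x L)

centralFubini : ℕ → ℝ → ℝ
centralFubini n x = ∑[ k ≤ n ] (fromℚ (ι (toℕ k !) Rat.* T n (toℕ k)) * x ^ toℕ k)

-- All m-tuples of natural numbers with sum n, each listed once.
compositions : (m n : ℕ) → List (Vec ℕ m)
compositions zero    zero    = [] ∷ []
compositions zero    (suc _) = []
compositions (suc m) n       =
  concatMap (λ j → map (j ∷_) (compositions m (n ∸ j))) (upTo (suc n))

factorials : ∀ {m} → Vec ℕ m → ℕ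
factorials []       = 1
factorials (j ∷ js) = j ! ℕ.* factorials js

factorials≢0 : ∀ {m} (js : Vec ℕ m) → ℕ.NonZero (factorials js)
factorials≢0 []       = _
factorials≢0 (j ∷ js) = ℕₚ.m*n≢0 (j !) (factorials js) {{ℕₚ._!≢0 j}} {{factorials≢0 js}}

multinomial : ∀ {m} → ℕ → Vec ℕ m → ℚ
multinomial n js = (pos (n !) Rat./ factorials js) {{factorials≢0 js}}

infixl 10 sumOver

sumOver : ∀ {A : Set} → List A → (A → ℝ) → ℝ
sumOver xs f = foldr (λ a s → f a + s) 0ℝ xs

syntax sumOver xs (λ a → e) = ∑[ a ∈ xs ] e

-- Write G = Σ 𝔠ₙ(x) tⁿ / n! and h = 2 sinh (t/2), so that hᵏ = Σ k! T(n,k) tⁿ / n! and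
-- G = 1 / (1 - x h). The r-th derivative of G in x is Gᵣ = r! hʳ Gʳ⁺¹, and x h G = G - 1
-- turns this into xʳ Gᵣ = r! (G - 1)ʳ G; expanding by the binomial theorem and comparing
-- coefficients of tⁿ gives the formula.

module Submission where

open import Algebra.Bundles using (CommutativeSemiring; CommutativeRing)
import Algebra.Construct.Pointwise as Pointwise
import Algebra.Definitions.RawSemiring
open import Algebra.Morphism.Structures using (IsSemiringHomomorphism)
import Algebra.Properties.CommutativeSemigroup as CommutativeSemigroupProperties
import Algebra.Properties.CommutativeSemiring.Binomial as Binomial
import Algebra.Properties.CommutativeSemiring.Exp as Exponentiation
import Algebra.Properties.Group as GroupProperties
import Algebra.Properties.Semiring.Exp
import Algebra.Properties.Semiring.Mult
import Algebra.Properties.Semiring.Sum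
import Algebra.Solver.Ring.NaturalCoefficients.Default as SemiringSolver
open import Algebra.Structures.Biased using (isCommutativeMonoidˡ; isCommutativeSemiringˡ)
open import Data.Fin using (Fin; toℕ) renaming (zero to fzero; suc to fsuc)
open import Data.Fin.Properties using (toℕ<n)
import Data.Integer as ℤ
import Data.Integer.Tactic.RingSolver as ℤSolver
open import Data.List using (List; []; _∷_; _++_; map; concatMap; foldr; applyUpTo; upTo)
open import Data.Nat as ℕ using (ℕ; zero; suc; z≤n; s≤s; _∸_; _!)
open import Data.Nat.Combinatorics using (_C_; nCk≡n!/k![n-k]!; k![n∸k]!∣n!)
import Data.Nat.DivMod as ℕ
import Data.Nat.Properties as ℕₚ
open import Data.Product as Product using (_,_; proj₁; proj₂; ∃-syntax)
open import Data.Rational as Rat using (ℚ; 0ℚ; 1ℚ; ½)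
import Data.Rational.Properties as ℚₚ
open import Data.Rational.Solver using (module +-*-Solver)
import Data.Rational.Unnormalised as ℚᵘ
import Data.Rational.Unnormalised.Properties as ℚᵘₚ
open import Data.Sum using (inj₁; inj₂)
open import Data.Vec using (Vec; []; _∷_; lookup)
open import Data.Vec.Functional using (Vector)
import Defs
open import Function using (_∘_; id)
open import Level using (_⊔_)
open import Relation.Binary.PropositionalEquality as ≡ using (_≡_; cong; cong₂)
import Relation.Binary.Reasoning.Setoid as SetoidReasoning

-- The variable x stays a fixed ring element and no series is ever differentiated or divided. `mono`
-- encodes the Leibniz rule for powers of x, and the recurrence this gives for Gᵣ₊₁ is solved by
-- multiplying it by G and comparing with G = 1 + x h G. The series for hᵏ comes from central
-- differences: k! T(n,k) is the k-th central difference of yⁿ at y = 0, and e^(yt), as a function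
-- of y, is an eigenfunction of the central difference with eigenvalue 2 sinh (t/2). One obstacle is
-- that `HasNthDerivativeAt` asks for each intermediate derivative on the whole line, including 0,
-- where the right-hand side of the formula makes no sense. So the derivatives are identified
-- everywhere with the polynomials `fubini r n`, and the formula is proved only for their values at
-- an invertible x.

-- Formal power series over a commutative semiring

module PowerSeries {c ℓ} (S : CommutativeSemiring c ℓ) where
  open CommutativeSemiring S
  open SetoidReasoning setoid
  open SemiringSolver S using (solve; _:+_; _:*_; _:=_)

  Series : Set c
  Series = ℕ → Carrier

  infix  4 _≋_
  infixl 6 _⊕_
  infixl 7 _⊛_

  _≋_ : Series → Series → Set ℓ
  a ≋ b = ∀ n → a n ≈ b n

  _⊕_ : Series → Series → Series
  (a ⊕ b) n = a n + b n

  -- The Cauchy product by recursion: with a = a₀ + t a′, the product is a₀ b + t (a′ b). The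
  -- semiring laws then follow by induction on the degree, without manipulating indexed sums.
  _⊛_ : Series → Series → Series
  (a ⊛ b) zero    = a 0 * b 0
  (a ⊛ b) (suc n) = a 0 * b (suc n) + (a ∘ suc ⊛ b) n

  constant : Carrier → Series
  constant k zero    = k
  constant k (suc n) = 0#

  -- The degree bound is what later permits replacing a series by a truncation of it.
  ⊛-cong-≤ : ∀ n {a a′ b b′} → (∀ i → i ℕ.≤ n → a i ≈ a′ i) → (∀ i → i ℕ.≤ n → b i ≈ b′ i) →
             (a ⊛ b) n ≈ (a′ ⊛ b′) n
  ⊛-cong-≤ zero    p q = *-cong (p 0 z≤n) (q 0 z≤n)
  ⊛-cong-≤ (suc n) p q = +-cong (*-cong (p 0 z≤n) (q (suc n) ℕₚ.≤-refl))
    (⊛-cong-≤ n (λ i i≤n → p (suc i) (s≤s i≤n)) (λ i i≤n → q i (ℕₚ.m≤n⇒m≤1+n i≤n)))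

  ⊛-cong : ∀ {a a′ b b′} → a ≋ a′ → b ≋ b′ → a ⊛ b ≋ a′ ⊛ b′
  ⊛-cong p q n = ⊛-cong-≤ n (λ i _ → p i) (λ i _ → q i)

  -- The mirror image of the defining recursion, which peels only the left factor; commutativity
  -- needs both.
  ⊛-sucʳ : ∀ a b n → (a ⊛ b) (suc n) ≈ a (suc n) * b 0 + (a ⊛ (b ∘ suc)) n
  ⊛-sucʳ a b zero    = +-comm (a 0 * b 1) (a 1 * b 0)
  ⊛-sucʳ a b (suc n) = begin
    a 0 * b (2 ℕ.+ n) + (a ∘ suc ⊛ b) (suc n)
      ≈⟨ +-congˡ (⊛-sucʳ (a ∘ suc) b n) ⟩
    a 0 * b (2 ℕ.+ n) + (a (2 ℕ.+ n) * b 0 + (a ∘ suc ⊛ b ∘ suc) n)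
      ≈⟨ solve 3 (λ p q r → p :+ (q :+ r) := q :+ (p :+ r)) refl _ _ _ ⟩
    a (2 ℕ.+ n) * b 0 + (a ⊛ b ∘ suc) (suc n) ∎

  ⊛-comm : ∀ a b → a ⊛ b ≋ b ⊛ a
  ⊛-comm a b zero    = *-comm (a 0) (b 0)
  ⊛-comm a b (suc n) = begin
    a 0 * b (suc n) + (a ∘ suc ⊛ b) n   ≈⟨ +-cong (*-comm (a 0) (b (suc n))) (⊛-comm (a ∘ suc) b n) ⟩
    b (suc n) * a 0 + (b ⊛ a ∘ suc) n   ≈⟨ ⊛-sucʳ b a n ⟨
    (b ⊛ a) (suc n)                     ∎

  ⊛-distribʳ : ∀ a b c → (b ⊕ c) ⊛ a ≋ (b ⊛ a) ⊕ (c ⊛ a)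
  ⊛-distribʳ a b c zero    = distribʳ (a 0) (b 0) (c 0)
  ⊛-distribʳ a b c (suc n) = begin
    (b 0 + c 0) * a (suc n) + ((b ⊕ c) ∘ suc ⊛ a) n
      ≈⟨ +-cong (distribʳ _ _ _) (⊛-distribʳ a (b ∘ suc) (c ∘ suc) n) ⟩
    (b 0 * a (suc n) + c 0 * a (suc n)) + ((b ∘ suc ⊛ a) n + (c ∘ suc ⊛ a) n)
      ≈⟨ solve 4 (λ p q r s → (p :+ q) :+ (r :+ s) := (p :+ r) :+ (q :+ s)) refl _ _ _ _ ⟩
    (b ⊛ a) (suc n) + (c ⊛ a) (suc n) ∎

  ⊛-scaleˡ : ∀ k a b n → ((λ i → k * a i) ⊛ b) n ≈ k * (a ⊛ b) n
  ⊛-scaleˡ k a b zero    = *-assoc k (a 0) (b 0)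
  ⊛-scaleˡ k a b (suc n) = begin
    k * a 0 * b (suc n) + ((λ i → k * a (suc i)) ⊛ b) n
      ≈⟨ +-cong (*-assoc _ _ _) (⊛-scaleˡ k (a ∘ suc) b n) ⟩
    k * (a 0 * b (suc n)) + k * (a ∘ suc ⊛ b) n
      ≈⟨ distribˡ _ _ _ ⟨
    k * (a ⊛ b) (suc n) ∎

  ⊛-zeroˡ : ∀ b n → ((λ _ → 0#) ⊛ b) n ≈ 0#
  ⊛-zeroˡ b zero    = zeroˡ (b 0)
  ⊛-zeroˡ b (suc n) = trans (+-cong (zeroˡ (b (suc n))) (⊛-zeroˡ b n)) (+-identityˡ 0#)

  constant-⊛ : ∀ k b n → (constant k ⊛ b) n ≈ k * b n
  constant-⊛ k b zero    = refl
  constant-⊛ k b (suc n) = trans (+-congˡ (⊛-zeroˡ b n)) (+-identityʳ (k * b (suc n)))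

  ⊛-assoc : ∀ a b c → (a ⊛ b) ⊛ c ≋ a ⊛ (b ⊛ c)
  ⊛-assoc a b c zero    = *-assoc (a 0) (b 0) (c 0)
  ⊛-assoc a b c (suc n) = begin
    -- The shifted series `(a ⊛ b) ∘ suc` is by definition this sum of two series, so distributivity
    -- and the induction hypothesis apply.
    a 0 * b 0 * c (suc n) + (((λ i → a 0 * b (suc i)) ⊕ (a ∘ suc ⊛ b)) ⊛ c) n
      ≈⟨ +-congˡ (⊛-distribʳ c (λ i → a 0 * b (suc i)) (a ∘ suc ⊛ b) n) ⟩
    a 0 * b 0 * c (suc n) + (((λ i → a 0 * b (suc i)) ⊛ c) n + ((a ∘ suc ⊛ b) ⊛ c) n)
      ≈⟨ +-congˡ (+-cong (⊛-scaleˡ (a 0) (b ∘ suc) c n) (⊛-assoc (a ∘ suc) b c n)) ⟩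
    a 0 * b 0 * c (suc n) + (a 0 * (b ∘ suc ⊛ c) n + (a ∘ suc ⊛ (b ⊛ c)) n)
      ≈⟨ solve 5 (λ p q r s t → p :* q :* r :+ (p :* s :+ t) := p :* (q :* r :+ s) :+ t) refl _ _ _ _ _ ⟩
    a 0 * (b ⊛ c) (suc n) + (a ∘ suc ⊛ (b ⊛ c)) n ∎

  commutativeSemiring : CommutativeSemiring c ℓ
  commutativeSemiring = record
    { Carrier = Series ; _≈_ = _≋_ ; _+_ = _⊕_ ; _*_ = _⊛_
    ; 0# = λ _ → 0# ; 1# = constant 1#
    ; isCommutativeSemiring = isCommutativeSemiringˡ record
      { +-isCommutativeMonoid = Pointwise.isCommutativeMonoid ℕ +-isCommutativeMonoid
      ; *-isCommutativeMonoid = isCommutativeMonoidˡ record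
        { isSemigroup = record
          { isMagma = record
            { isEquivalence = Pointwise.isEquivalence ℕ isEquivalence
            ; ∙-cong = ⊛-cong
            }
          ; assoc = ⊛-assoc
          }
        ; identityˡ = λ b n → trans (constant-⊛ 1# b n) (*-identityˡ (b n))
        ; comm = ⊛-comm
        }
      ; distribʳ = ⊛-distribʳ
      ; zeroˡ = ⊛-zeroˡ
      }
    }

module SemiringTheory {c ℓ} (S : CommutativeSemiring c ℓ) where
  open CommutativeSemiring S public
  open Algebra.Definitions.RawSemiring rawSemiring public using (product)
  open Algebra.Properties.Semiring.Exp semiring public
  open Algebra.Properties.Semiring.Mult semiring public
  open Algebra.Properties.Semiring.Sum semiring public

-- Substitution into a series without constant term, and the derivatives of 1 / (1 - x h)

module Composition {c ℓ} (R : CommutativeRing c ℓ) where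
  open CommutativeRing R using (commutativeSemiring; -_; -‿inverseʳ; +-group)
  open SemiringTheory commutativeSemiring hiding (zero)
  open PowerSeries commutativeSemiring renaming (commutativeSemiring to series)
  module Series = SemiringTheory series
  open GroupProperties +-group using (∙-cancelʳ)

  coeff-× : ∀ m a n → (m Series.× a) n ≡ m × a n
  coeff-× zero    a n = ≡.refl
  coeff-× (suc m) a n = ≡.cong (a n +_) (coeff-× m a n)

  coeff-sum : ∀ m (a : Vector Series m) n → Series.sum a n ≡ sum (λ i → a i n)
  coeff-sum zero    a n = ≡.refl
  coeff-sum (suc m) a n = ≡.cong (a fzero n +_) (coeff-sum m (a ∘ fsuc) n)

  constant-^ : ∀ k m → constant k Series.^ m ≋ constant (k ^ m)
  constant-^ k zero    n       = refl
  constant-^ k (suc m) zero    = *-congˡ (constant-^ k m 0)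
  constant-^ k (suc m) (suc n) = trans (constant-⊛ k (constant k Series.^ m) (suc n))
    (trans (*-congˡ (constant-^ k m (suc n))) (zeroʳ k))

  sum-last : ∀ n (f : ℕ → Carrier) → sum {suc n} (f ∘ toℕ) ≈ sum {n} (f ∘ toℕ) + f n
  sum-last zero    f = +-comm (f 0) 0#
  sum-last (suc n) f = trans (+-congˡ (sum-last n (f ∘ suc))) (sym (+-assoc _ _ _))

  -- In degree n the coefficient `b n` meets only `a 0`, which vanishes.
  ⊛-cong-< : ∀ {a} → a 0 ≈ 0# → ∀ n {b b′} → (∀ i → i ℕ.< n → b i ≈ b′ i) → (a ⊛ b) n ≈ (a ⊛ b′) n
  ⊛-cong-< a₀ zero    p = trans (*-congʳ a₀) (trans (trans (zeroˡ _) (sym (zeroˡ _))) (*-congʳ (sym a₀)))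
  ⊛-cong-< a₀ (suc n) {b} {b′} p = +-cong
    (trans (*-congʳ a₀) (trans (trans (zeroˡ _) (sym (zeroˡ _))) (*-congʳ (sym a₀))))
    (⊛-cong-≤ n (λ _ _ → refl) (λ i i≤n → p i (s≤s i≤n)))

  ⊛-sum : ∀ m a (b : Vector Series m) (k : Vector Carrier m) n →
          sum (λ i → (a ⊛ b i) n * k i) ≈ (a ⊛ (λ j → sum (λ i → b i j * k i))) n
  ⊛-sum zero    a b k n = sym (Series.zeroʳ a n)
  ⊛-sum (suc m) a b k n = begin
    (a ⊛ b fzero) n * k fzero + sum (λ i → (a ⊛ b (fsuc i)) n * k (fsuc i))
      ≈⟨ +-cong scale (⊛-sum m a (b ∘ fsuc) (k ∘ fsuc) n) ⟩
    (a ⊛ (λ j → b fzero j * k fzero)) n + (a ⊛ (λ j → sum (λ i → b (fsuc i) j * k (fsuc i)))) n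
      ≈⟨ Series.distribˡ a _ _ n ⟨
    (a ⊛ (λ j → sum (λ i → b i j * k i))) n ∎
    where
    open SetoidReasoning setoid
    scale : (a ⊛ b fzero) n * k fzero ≈ (a ⊛ (λ j → b fzero j * k fzero)) n
    scale = begin
      (a ⊛ b fzero) n * k fzero             ≈⟨ *-comm _ _ ⟩
      k fzero * (a ⊛ b fzero) n             ≈⟨ *-congˡ (⊛-comm a (b fzero) n) ⟩
      k fzero * (b fzero ⊛ a) n             ≈⟨ ⊛-scaleˡ (k fzero) (b fzero) a n ⟨
      ((λ j → k fzero * b fzero j) ⊛ a) n   ≈⟨ ⊛-comm _ a n ⟩
      (a ⊛ (λ j → k fzero * b fzero j)) n   ≈⟨ ⊛-cong {a} (λ _ → refl) (λ j → *-comm (k fzero) (b fzero j)) n ⟩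
      (a ⊛ (λ j → b fzero j * k fzero)) n   ∎

  module _ (h : Series) (h₀ : h 0 ≈ 0#) where
    open SetoidReasoning setoid

    -- Each further factor `h` raises the order by one: degree n of the product sees the previous
    -- power only below n, where it vanishes by induction.
    order-^ : ∀ k n → n ℕ.< k → (h Series.^ k) n ≈ 0#
    order-^ (suc k) n (s≤s n≤k) = trans
      (⊛-cong-< {h} h₀ n {h Series.^ k} {λ _ → 0#} (λ i i<n → order-^ k i (ℕₚ.<-≤-trans i<n n≤k)))
      (Series.zeroʳ h n)

    -- The series Σₖ c k hᵏ; as hᵏ starts in degree k, the terms with k > n do not matter.
    compose : (ℕ → Carrier) → Series
    compose c n = ∑[ k ≤ n ] ((h Series.^ toℕ k) n * c (toℕ k))

    compose-truncation : ∀ c N n → n ℕ.< N → sum {N} (λ k → (h Series.^ toℕ k) n * c (toℕ k)) ≈ compose c n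
    compose-truncation c (suc N) n (s≤s n≤N) with ℕₚ.m≤n⇒m<n∨m≡n n≤N
    ... | inj₂ ≡.refl = refl
    ... | inj₁ n<N    = begin
      sum {suc N} (f ∘ toℕ)     ≈⟨ sum-last N f ⟩
      sum {N} (f ∘ toℕ) + f N   ≈⟨ +-cong (compose-truncation c N n n<N) (trans (*-congʳ (order-^ N n n<N)) (zeroˡ (c N))) ⟩
      compose c n + 0#          ≈⟨ +-identityʳ _ ⟩
      compose c n               ∎
      where
      f : ℕ → Carrier
      f k = (h Series.^ k) n * c k

    -- The Horner step Σ cₖ hᵏ = c₀ + h Σ cₖ₊₁ hᵏ. A recursion for the coefficients c thereby
    -- becomes an equation between series.
    compose-suc : ∀ c → compose c ≋ constant (c 0) ⊕ h ⊛ compose (c ∘ suc)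
    compose-suc c n = +-cong (head n) (begin
      sum {n} (λ k → (h ⊛ h Series.^ toℕ k) n * c (suc (toℕ k)))
        ≈⟨ ⊛-sum n h (λ k → h Series.^ toℕ k) (λ k → c (suc (toℕ k))) n ⟩
      (h ⊛ (λ j → sum {n} (λ k → (h Series.^ toℕ k) j * c (suc (toℕ k))))) n
        -- In degree j the inner sum has n terms where `compose` has j + 1. Only j < n matters here,
        -- and there the surplus terms vanish.
        ≈⟨ ⊛-cong-< {h} h₀ n (λ j j<n → compose-truncation (c ∘ suc) n j j<n) ⟩
      (h ⊛ compose (c ∘ suc)) n ∎)
      where
      head : ∀ n → constant 1# n * c 0 ≈ constant (c 0) n
      head zero    = *-identityˡ (c 0)
      head (suc n) = zeroˡ (c 0)

    compose-+ : ∀ c d → compose (λ k → c k + d k) ≋ compose c ⊕ compose d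
    compose-+ c d n = trans (sum-cong-≋ {suc n} (λ k → distribˡ ((h Series.^ toℕ k) n) (c (toℕ k)) (d (toℕ k))))
      (∑-distrib-+ {suc n} (λ k → (h Series.^ toℕ k) n * c (toℕ k)) (λ k → (h Series.^ toℕ k) n * d (toℕ k)))

    compose-* : ∀ s c → compose (λ k → s * c k) ≋ constant s ⊛ compose c
    compose-* s c n = begin
      compose (λ k → s * c k) n                                   ≈⟨ sum-cong-≋ {suc n} (λ k → swap ((h Series.^ toℕ k) n) s (c (toℕ k))) ⟩
      ∑[ k ≤ n ] (s * ((h Series.^ toℕ k) n * c (toℕ k)))          ≈⟨ *-distribˡ-sum {suc n} s (λ k → (h Series.^ toℕ k) n * c (toℕ k)) ⟨
      s * compose c n                                             ≈⟨ constant-⊛ s (compose c) n ⟨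
      (constant s ⊛ compose c) n                                  ∎

      where
      open CommutativeSemigroupProperties *-commutativeSemigroup renaming (x∙yz≈y∙xz to swap)

    compose-0 : compose (λ _ → 0#) ≋ λ _ → 0#
    compose-0 n = trans (sum-cong-≋ {suc n} (λ k → zeroʳ ((h Series.^ toℕ k) n))) (sum-replicate-zero (suc n))

    compose-× : ∀ m c → compose (λ k → m × c k) ≋ m Series.× compose c
    compose-× zero    c = compose-0
    compose-× (suc m) c n = trans (compose-+ c (λ k → m × c k) n) (+-congˡ (compose-× m c n))

  -- mono x k r is the r-th derivative of x ^ k.
  mono : Carrier → ℕ → ℕ → Carrier
  mono x k       zero    = x ^ k
  mono x zero    (suc r) = 0#
  mono x (suc k) (suc r) = x * mono x k (suc r) + suc r × mono x k r

  module _ (h : Series) (h₀ : h 0 ≈ 0#) (x : Carrier) where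
    private
      H = compose h h₀
      X = constant x
      module Solver = SemiringSolver series

    -- The r-th derivative in x of G 0 = 1 / (1 - x h).
    G : ℕ → Series
    G r = H (λ k → mono x k r)

    W : Series
    W = h ⊛ (X ⊛ G 0)

    -- The coefficient sequence xᵏ is multiplied by x under a shift. This equation takes the place
    -- of the quotient 1 / (1 - x h).
    G-resolvent : G 0 ≋ constant 1# ⊕ W
    G-resolvent n = trans (compose-suc h h₀ (x ^_) n) (+-congˡ (⊛-cong {h} (λ _ → refl) (compose-* h h₀ x (x ^_)) n))

    -- This is G = 1 + h x G differentiated r + 1 times in x; the recursive clause of `mono` is the
    -- Leibniz rule for the factor x.
    G-suc : ∀ r → G (suc r) ≋ h ⊛ (X ⊛ G (suc r) ⊕ suc r Series.× G r)
    G-suc r n = begin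
      G (suc r) n
        ≈⟨ compose-suc h h₀ (λ k → mono x k (suc r)) n ⟩
      constant 0# n + (h ⊛ H (λ k → mono x (suc k) (suc r))) n
        ≈⟨ +-congʳ (zeros n) ⟩
      0# + (h ⊛ H (λ k → mono x (suc k) (suc r))) n
        ≈⟨ +-identityˡ _ ⟩
      (h ⊛ H (λ k → x * mono x k (suc r) + suc r × mono x k r)) n
        ≈⟨ ⊛-cong {h} (λ _ → refl) (λ i → trans (compose-+ h h₀ (λ k → x * mono x k (suc r)) (λ k → suc r × mono x k r) i)
             (+-cong (compose-* h h₀ x (λ k → mono x k (suc r)) i) (compose-× h h₀ (suc r) (λ k → mono x k r) i))) n ⟩
      (h ⊛ (X ⊛ G (suc r) ⊕ suc r Series.× G r)) n ∎
      where
      open SetoidReasoning setoid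
      zeros : ∀ n → constant 0# n ≈ 0#
      zeros zero    = refl
      zeros (suc n) = refl

    -- Multiply the two recurrences by A and by G 0 and compare: both contain h X G A.
    resolvent-solves : ∀ A B → A ≋ h ⊛ (X ⊛ A ⊕ B) → A ≋ h ⊛ (G 0 ⊛ B)
    resolvent-solves A B A≋ n = ∙-cancelʳ ((W ⊛ A) n) (A n) ((h ⊛ (G 0 ⊛ B)) n) (eq n)
      where
      open SetoidReasoning Series.setoid
      open Solver
      eq : A ⊕ W ⊛ A ≋ h ⊛ (G 0 ⊛ B) ⊕ W ⊛ A
      eq = begin
        A ⊕ W ⊛ A                    ≈⟨ Series.+-congʳ {W ⊛ A} (Series.*-identityˡ A) ⟨
        constant 1# ⊛ A ⊕ W ⊛ A      ≈⟨ ⊛-distribʳ A (constant 1#) W ⟨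
        (constant 1# ⊕ W) ⊛ A        ≈⟨ Series.*-congʳ {A} G-resolvent ⟨
        G 0 ⊛ A                      ≈⟨ Series.*-congˡ {G 0} A≋ ⟩
        G 0 ⊛ (h ⊛ (X ⊛ A ⊕ B))      ≈⟨ solve 5 (λ g h x a b → g :* (h :* (x :* a :+ b)) := h :* (g :* b) :+ h :* (x :* g) :* a) Series.refl (G 0) h X A B ⟩
        h ⊛ (G 0 ⊛ B) ⊕ W ⊛ A        ∎

    -- Solving `G-suc` yields Gᵣ₊₁ = (r + 1) h G Gᵣ. With one factor x for each order, h G always
    -- occurs as x h G = `W`, which can be expressed by G alone.
    G-power : ∀ r → X Series.^ r ⊛ G r ≋ (r !) Series.× (W Series.^ r ⊛ G 0)
    G-power zero    = Series.sym (Series.+-identityʳ (constant 1# ⊛ G 0))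
    G-power (suc r) = begin
      X Series.^ suc r ⊛ G (suc r)
        ≈⟨ Series.*-congˡ {X Series.^ suc r} (resolvent-solves (G (suc r)) (suc r Series.× G r) (G-suc r)) ⟩
      X Series.^ suc r ⊛ (h ⊛ (G 0 ⊛ (suc r Series.× G r)))
        ≈⟨ solve 5 (λ x p h g b → x :* p :* (h :* (g :* b)) := h :* (x :* g) :* p :* b) Series.refl X (X Series.^ r) h (G 0) (suc r Series.× G r) ⟩
      W ⊛ X Series.^ r ⊛ (suc r Series.× G r)
        ≈⟨ Series.×-comm-* (suc r) (W ⊛ X Series.^ r) (G r) ⟩
      suc r Series.× (W ⊛ X Series.^ r ⊛ G r)
        ≈⟨ Series.×-congʳ (suc r) (⊛-assoc W (X Series.^ r) (G r)) ⟩
      suc r Series.× (W ⊛ (X Series.^ r ⊛ G r))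
        ≈⟨ Series.×-congʳ (suc r) (Series.*-congˡ {W} (G-power r)) ⟩
      suc r Series.× (W ⊛ ((r !) Series.× (W Series.^ r ⊛ G 0)))
        ≈⟨ Series.×-congʳ (suc r) (Series.×-comm-* (r !) W (W Series.^ r ⊛ G 0)) ⟩
      suc r Series.× ((r !) Series.× (W ⊛ (W Series.^ r ⊛ G 0)))
        ≈⟨ Series.×-assocˡ (W ⊛ (W Series.^ r ⊛ G 0)) (suc r) (r !) ⟩
      (suc r !) Series.× (W ⊛ (W Series.^ r ⊛ G 0))
        ≈⟨ Series.×-congʳ (suc r !) (⊛-assoc W (W Series.^ r) (G 0)) ⟨
      (suc r !) Series.× (W Series.^ suc r ⊛ G 0) ∎
      where
      open SetoidReasoning Series.setoid
      open Solver

    W≋G-1 : W ≋ G 0 ⊕ constant (- 1#)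
    W≋G-1 n = begin
      W n                                       ≈⟨ +-identityʳ (W n) ⟨
      W n + 0#                                  ≈⟨ +-congˡ (1-1 n) ⟨
      W n + (constant 1# n + constant (- 1#) n) ≈⟨ +-assoc _ _ _ ⟨
      W n + constant 1# n + constant (- 1#) n   ≈⟨ +-congʳ (trans (+-comm _ _) (sym (G-resolvent n))) ⟩
      G 0 n + constant (- 1#) n                 ∎
      where
      open SetoidReasoning setoid
      1-1 : ∀ n → constant 1# n + constant (- 1#) n ≈ 0#
      1-1 zero    = -‿inverseʳ 1#
      1-1 (suc n) = +-identityʳ 0#

    -- The factor `G 0` left outside the binomial expansion raises each exponent from k to k + 1,
    -- whence the k + 1 indices of the inner sum.
    G-expansion : ∀ r n → x ^ r * G r n ≈
      (r !) × ∑[ k ≤ r ] ((r C toℕ k) × ((- 1#) ^ (r ∸ toℕ k) * (G 0 Series.^ suc (toℕ k)) n))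
    G-expansion r n = begin
      x ^ r * G r n
        ≈⟨ constant-⊛ (x ^ r) (G r) n ⟨
      (constant (x ^ r) ⊛ G r) n
        ≈⟨ Series.*-congʳ {G r} (constant-^ x r) n ⟨
      (X Series.^ r ⊛ G r) n
        ≈⟨ G-power r n ⟩
      ((r !) Series.× (W Series.^ r ⊛ G 0)) n
        ≡⟨ coeff-× (r !) (W Series.^ r ⊛ G 0) n ⟩
      (r !) × (W Series.^ r ⊛ G 0) n
        ≈⟨ ×-congʳ (r !) (expand n) ⟩
      (r !) × Series.sum {suc r} (λ k → binomialTerm r k ⊛ G 0) n
        ≡⟨ ≡.cong ((r !) ×_) (coeff-sum (suc r) (λ k → binomialTerm r k ⊛ G 0) n) ⟩
      (r !) × ∑[ k ≤ r ] ((binomialTerm r k ⊛ G 0) n)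
        ≈⟨ ×-congʳ (r !) (sum-cong-≋ {suc r} (λ k → term (r C toℕ k) (toℕ k) (r ∸ toℕ k))) ⟩
      (r !) × ∑[ k ≤ r ] ((r C toℕ k) × ((- 1#) ^ (r ∸ toℕ k) * (G 0 Series.^ suc (toℕ k)) n)) ∎
      where
      open SetoidReasoning setoid

      binomialTerm = Binomial.binomialTerm series (G 0) (constant (- 1#))

      expand : W Series.^ r ⊛ G 0 ≋ Series.sum {suc r} (λ k → binomialTerm r k ⊛ G 0)
      expand = Series.trans
        (Series.*-congʳ {G 0} (Series.trans (Series.^-congˡ r W≋G-1) (Binomial.theorem series r (G 0) (constant (- 1#)))))
        (Series.*-distribʳ-sum {suc r} (G 0) (binomialTerm r))

      term : ∀ m k j → (m Series.× (G 0 Series.^ k ⊛ constant (- 1#) Series.^ j) ⊛ G 0) n ≈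
                       m × ((- 1#) ^ j * (G 0 Series.^ suc k) n)
      term m k j = begin
        (m Series.× (G 0 Series.^ k ⊛ constant (- 1#) Series.^ j) ⊛ G 0) n
          ≈⟨ Series.×-assoc-* m (G 0 Series.^ k ⊛ constant (- 1#) Series.^ j) (G 0) n ⟩
        (m Series.× (G 0 Series.^ k ⊛ constant (- 1#) Series.^ j ⊛ G 0)) n
          ≡⟨ coeff-× m (G 0 Series.^ k ⊛ constant (- 1#) Series.^ j ⊛ G 0) n ⟩
        m × (G 0 Series.^ k ⊛ constant (- 1#) Series.^ j ⊛ G 0) n
          ≈⟨ ×-congʳ m (Solver.solve 3 (λ p c g → p Solver.:* c Solver.:* g Solver.:= c Solver.:* (g Solver.:* p))
               Series.refl (G 0 Series.^ k) (constant (- 1#) Series.^ j) (G 0) n) ⟩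
        m × (constant (- 1#) Series.^ j ⊛ G 0 Series.^ suc k) n
          ≈⟨ ×-congʳ m (Series.*-congʳ {G 0 Series.^ suc k} (constant-^ (- 1#) j) n) ⟩
        m × (constant ((- 1#) ^ j) ⊛ G 0 Series.^ suc k) n
          ≈⟨ ×-congʳ m (constant-⊛ ((- 1#) ^ j) (G 0 Series.^ suc k) n) ⟩
        m × ((- 1#) ^ j * (G 0 Series.^ suc k) n) ∎

-- Powers of 2 sinh (t/2) and central factorial numbers

module CentralSeries where
  open CommutativeRing ℚₚ.+-*-commutativeRing using (commutativeSemiring)
  open SemiringTheory commutativeSemiring using (_^_; _×_; sum; sum-cong-≗; *-distribˡ-sum)
  open PowerSeries commutativeSemiring renaming (commutativeSemiring to series)
  module Series = SemiringTheory series
  open Defs.Central using (ι; T)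
  open Defs.Central.Expansion using (ι-suc; ι-*; 1/n*n; Δ; Δ^; Δ^-cong; Δ^-*; Δ^-+; k!T)
  open Rat using (_+_; _*_; -_; _/_)
  open ≡ using (refl; sym; trans)
  open ≡.≡-Reasoning
  open +-*-Solver

  1/!_ : ℕ → ℚ
  1/! n = (ℤ.+ 1 / n !) {{n ℕₚ.!≢0}}

  1/!-inverse : ∀ n → 1/! n * ι (n !) ≡ 1ℚ
  1/!-inverse n = 1/n*n (n !) {{n ℕₚ.!≢0}}

  ×-ι : ∀ m q → m × q ≡ ι m * q
  ×-ι zero    q = sym (ℚₚ.*-zeroˡ q)
  ×-ι (suc m) q = begin
    q + m × q        ≡⟨ cong (q +_) (×-ι m q) ⟩
    q + ι m * q      ≡⟨ solve 2 (λ q i → q :+ i :* q := (con 1ℚ :+ i) :* q) refl q (ι m) ⟩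
    (1ℚ + ι m) * q   ≡⟨ cong (_* q) (ι-suc m) ⟨
    ι (suc m) * q    ∎

  C-*-factorials : ∀ {n k} → k ℕ.≤ n → (n C k) ℕ.* (k ! ℕ.* (n ∸ k) !) ≡ n !
  C-*-factorials {n} {k} k≤n = trans (cong (ℕ._* (k ! ℕ.* (n ∸ k) !)) (nCk≡n!/k![n-k]! k≤n)) (ℕ.m/n*n≡m (k![n∸k]!∣n! k≤n))
    where instance _ = k ℕₚ.!* n ∸ k !≢0

  C-1/! : ∀ {n k} → k ℕ.≤ n → 1/! n * ι (n C k) ≡ 1/! k * 1/! (n ∸ k)
  C-1/! {n} {k} k≤n = begin
    c * D                              ≡⟨ solve 2 (λ c d → c :* d := c :* d :* (con 1ℚ :* con 1ℚ)) refl c D ⟩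
    c * D * (1ℚ * 1ℚ)                  ≡⟨ cong₂ (λ s t → c * D * (s * t)) (1/!-inverse k) (1/!-inverse (n ∸ k)) ⟨
    c * D * ((a * A) * (b * B))        ≡⟨ solve 6 (λ a A b B c d → c :* d :* ((a :* A) :* (b :* B)) := c :* (d :* (A :* B)) :* (a :* b)) refl a A b B c D ⟩
    c * (D * (A * B)) * (a * b)        ≡⟨ cong (λ t → c * t * (a * b)) (trans (cong (D *_) (sym (ι-* (k !) ((n ∸ k) !)))) (sym (ι-* (n C k) (k ! ℕ.* (n ∸ k) !)))) ⟩
    c * ι ((n C k) ℕ.* (k ! ℕ.* (n ∸ k) !)) * (a * b)   ≡⟨ cong (λ t → c * ι t * (a * b)) (C-*-factorials k≤n) ⟩
    c * ι (n !) * (a * b)              ≡⟨ cong (_* (a * b)) (1/!-inverse n) ⟩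
    1ℚ * (a * b)                       ≡⟨ ℚₚ.*-identityˡ (a * b) ⟩
    a * b                              ∎
    where
    a = 1/! k
    A = ι (k !)
    b = 1/! (n ∸ k)
    B = ι ((n ∸ k) !)
    c = 1/! n
    D = ι (n C k)

  ⊛-sum : ∀ a b n → (a ⊛ b) n ≡ sum {suc n} (λ k → a (toℕ k) * b (n ∸ toℕ k))
  ⊛-sum a b zero    = sym (ℚₚ.+-identityʳ (a 0 * b 0))
  ⊛-sum a b (suc n) = cong (a 0 * b (suc n) +_) (⊛-sum (a ∘ suc) b n)

  exp : ℚ → Series
  exp y n = 1/! n * y ^ n

  -- The binomial theorem divided by n!, with the factorials of `C-1/!` distributed over the two
  -- factors.
  exp-+ : ∀ y z n → exp (y + z) n ≡ (exp y ⊛ exp z) n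
  exp-+ y z n = begin
    1/! n * (y + z) ^ n
      ≡⟨ cong (1/! n *_) (Binomial.theorem commutativeSemiring n y z) ⟩
    1/! n * sum {suc n} (λ k → (n C toℕ k) × (y ^ toℕ k * z ^ (n ∸ toℕ k)))
      ≡⟨ *-distribˡ-sum {suc n} (1/! n) (λ k → (n C toℕ k) × (y ^ toℕ k * z ^ (n ∸ toℕ k))) ⟩
    sum {suc n} (λ k → 1/! n * ((n C toℕ k) × (y ^ toℕ k * z ^ (n ∸ toℕ k))))
      ≡⟨ sum-cong-≗ {suc n} (λ k → term (ℕ.s≤s⁻¹ (toℕ<n k))) ⟩
    sum {suc n} (λ k → exp y (toℕ k) * exp z (n ∸ toℕ k))
      ≡⟨ ⊛-sum (exp y) (exp z) n ⟨
    (exp y ⊛ exp z) n ∎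
    where
    term : ∀ {k} → k ℕ.≤ n → 1/! n * ((n C k) × (y ^ k * z ^ (n ∸ k))) ≡ exp y k * exp z (n ∸ k)
    term {k} k≤n = begin
      1/! n * ((n C k) × (y ^ k * z ^ (n ∸ k)))
        ≡⟨ cong (1/! n *_) (×-ι (n C k) (y ^ k * z ^ (n ∸ k))) ⟩
      1/! n * (ι (n C k) * (y ^ k * z ^ (n ∸ k)))
        ≡⟨ ℚₚ.*-assoc (1/! n) (ι (n C k)) (y ^ k * z ^ (n ∸ k)) ⟨
      1/! n * ι (n C k) * (y ^ k * z ^ (n ∸ k))
        ≡⟨ cong (_* (y ^ k * z ^ (n ∸ k))) (C-1/! k≤n) ⟩
      1/! k * 1/! (n ∸ k) * (y ^ k * z ^ (n ∸ k))
        ≡⟨ solve 4 (λ a b p q → a :* b :* (p :* q) := (a :* p) :* (b :* q)) refl (1/! k) (1/! (n ∸ k)) (y ^ k) (z ^ (n ∸ k)) ⟩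
      exp y k * exp z (n ∸ k) ∎

  2sinh : Series
  2sinh n = exp ½ n + - 1ℚ * exp (- ½) n

  -- A shift of y by ½ or -½ multiplies e^(yt) by e^(t/2) or e^(-t/2), so the difference multiplies
  -- it by a series independent of y.
  Δ-exp : ∀ n y → Δ (λ z → exp z n) y ≡ (2sinh ⊛ exp y) n
  Δ-exp n y = begin
    exp (y + ½) n + - exp (y + - ½) n
      ≡⟨ cong₂ (λ s t → s + - t) (shift ½) (shift (- ½)) ⟩
    (exp ½ ⊛ exp y) n + - (exp (- ½) ⊛ exp y) n
      ≡⟨ solve 2 (λ p q → p :+ :- q := p :+ :- con 1ℚ :* q) refl ((exp ½ ⊛ exp y) n) ((exp (- ½) ⊛ exp y) n) ⟩
    (exp ½ ⊛ exp y) n + - 1ℚ * (exp (- ½) ⊛ exp y) n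
      ≡⟨ cong ((exp ½ ⊛ exp y) n +_) (⊛-scaleˡ (- 1ℚ) (exp (- ½)) (exp y) n) ⟨
    (exp ½ ⊛ exp y) n + ((λ i → - 1ℚ * exp (- ½) i) ⊛ exp y) n
      ≡⟨ ⊛-distribʳ (exp y) (exp ½) (λ i → - 1ℚ * exp (- ½) i) n ⟨
    (2sinh ⊛ exp y) n ∎
    where
    shift : ∀ z → exp (y + z) n ≡ (exp z ⊛ exp y) n
    shift z = trans (cong (λ t → exp t n) (ℚₚ.+-comm y z)) (exp-+ z y n)

  -- Differences act on y and the product acts on t; as `a` does not involve y, linearity lets the
  -- two commute.
  Δ^-⊛ : ∀ k a (s : ℚ → Series) n x →
         Δ^ k (λ y → (a ⊛ s y) n) x ≡ (a ⊛ (λ m → Δ^ k (λ y → s y m) x)) n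
  Δ^-⊛ k a s zero    x = Δ^-* k (a 0) (λ y → s y 0) x
  Δ^-⊛ k a s (suc n) x = trans
    (Δ^-+ k (λ y → a 0 * s y (suc n)) (λ y → (a ∘ suc ⊛ s y) n) x)
    (cong₂ _+_ (Δ^-* k (a 0) (λ y → s y (suc n)) x) (Δ^-⊛ k (a ∘ suc) s n x))

  Δ^-exp : ∀ k n → Δ^ k (λ y → exp y n) 0ℚ ≡ (2sinh Series.^ k) n
  Δ^-exp zero    zero    = refl
  Δ^-exp zero    (suc n) = solve 2 (λ a b → a :* (con 0ℚ :* b) := con 0ℚ) refl (1/! suc n) (0ℚ ^ n)
  Δ^-exp (suc k) n       = begin
    Δ^ k (Δ (λ y → exp y n)) 0ℚ                      ≡⟨ Δ^-cong k (Δ-exp n) 0ℚ ⟩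
    Δ^ k (λ y → (2sinh ⊛ exp y) n) 0ℚ                ≡⟨ Δ^-⊛ k 2sinh exp n 0ℚ ⟩
    (2sinh ⊛ (λ m → Δ^ k (λ y → exp y m) 0ℚ)) n      ≡⟨ ⊛-cong {2sinh} (λ _ → refl) (Δ^-exp k) n ⟩
    (2sinh ⊛ 2sinh Series.^ k) n                     ∎

  -- Both sides are the k-th central difference of yⁿ at 0, since yⁿ is n! times the coefficient of
  -- tⁿ in e^(yt), and e^(yt) is 1 at y = 0.
  k!T≡n!2sinh^k : ∀ n k → ι (k !) * T n k ≡ ι (n !) * (2sinh Series.^ k) n
  k!T≡n!2sinh^k n k = begin
    ι (k !) * T n k                         ≡⟨ k!T n k ⟩
    Δ^ k (_^ n) 0ℚ                          ≡⟨ Δ^-cong k (λ y → power y) 0ℚ ⟩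
    Δ^ k (λ y → ι (n !) * exp y n) 0ℚ       ≡⟨ Δ^-* k (ι (n !)) (λ y → exp y n) 0ℚ ⟩
    ι (n !) * Δ^ k (λ y → exp y n) 0ℚ       ≡⟨ cong (ι (n !) *_) (Δ^-exp k n) ⟩
    ι (n !) * (2sinh Series.^ k) n          ∎
    where
    power : ∀ y → y ^ n ≡ ι (n !) * exp y n
    power y = begin
      y ^ n                         ≡⟨ ℚₚ.*-identityˡ (y ^ n) ⟨
      1ℚ * y ^ n                    ≡⟨ cong (_* y ^ n) (1/!-inverse n) ⟨
      1/! n * ι (n !) * y ^ n       ≡⟨ solve 3 (λ a b c → a :* b :* c := b :* (a :* c)) refl (1/! n) (ι (n !)) (y ^ n) ⟩
      ι (n !) * exp y n             ∎

-- Multinomial coefficients as products of reciprocal factorials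

module Multinomial where
  open Defs using (factorials; factorials≢0; multinomial)
  open Defs.Central using (ι)
  open Defs.Central.Expansion using (ι-*)
  open CentralSeries using (1/!_; 1/!-inverse)
  open Rat using (_*_; _/_)
  open ≡ using (refl; sym; trans)
  open ≡.≡-Reasoning
  open +-*-Solver

  /-*-cancel : ∀ m n .{{_ : ℕ.NonZero n}} → (ℤ.+ m / n) * ι n ≡ ι m
  /-*-cancel m n@(suc k) = ℚₚ.toℚᵘ-injective
      (ℚᵘₚ.≃-trans (ℚₚ.toℚᵘ-homo-* (ℤ.+ m / n) (ι n))
      (ℚᵘₚ.≃-trans (ℚᵘₚ.*-cong (ℚₚ.toℚᵘ-fromℚᵘ (ℚᵘ.mkℚᵘ (ℤ.+ m) k)) (ℚₚ.toℚᵘ-fromℚᵘ (ℚᵘ.mkℚᵘ (ℤ.+ n) 0)))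
      (ℚᵘₚ.≃-trans (ℚᵘ.*≡* (rearrange (ℤ.+ m) (ℤ.+ n))) (ℚᵘₚ.≃-sym (ℚₚ.toℚᵘ-fromℚᵘ (ℚᵘ.mkℚᵘ (ℤ.+ m) 0))))))
    where
    rearrange : ∀ m n → (m ℤ.* n) ℤ.* ℤ.+ 1 ≡ m ℤ.* (n ℤ.* ℤ.+ 1)
    rearrange = ℤSolver.solve-∀

  -- Unlike the quotient in `multinomial`, this product splits entry by entry, as an induction on
  -- the tuple requires.
  1/factorials : ∀ {m} → Vec ℕ m → ℚ
  1/factorials []       = 1ℚ
  1/factorials (j ∷ js) = 1/! j * 1/factorials js

  1/factorials-inverse : ∀ {m} (js : Vec ℕ m) → 1/factorials js * ι (factorials js) ≡ 1ℚ
  1/factorials-inverse []       = refl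
  1/factorials-inverse (j ∷ js) = begin
    a * b * ι (j ! ℕ.* factorials js)          ≡⟨ cong (a * b *_) (ι-* (j !) (factorials js)) ⟩
    a * b * (ι (j !) * ι (factorials js))      ≡⟨ solve 4 (λ a b c d → a :* b :* (c :* d) := (a :* c) :* (b :* d)) refl a b (ι (j !)) (ι (factorials js)) ⟩
    a * ι (j !) * (b * ι (factorials js))      ≡⟨ cong₂ _*_ (1/!-inverse j) (1/factorials-inverse js) ⟩
    1ℚ                                         ∎
    where
    a = 1/! j
    b = 1/factorials js

  multinomial≡ : ∀ {m} n (js : Vec ℕ m) → multinomial n js ≡ ι (n !) * 1/factorials js
  multinomial≡ n js = begin
    multinomial n js                                              ≡⟨ ℚₚ.*-identityʳ (multinomial n js) ⟨
    multinomial n js * 1ℚ                                         ≡⟨ cong (multinomial n js *_) (1/factorials-inverse js) ⟨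
    multinomial n js * (1/factorials js * ι (factorials js))      ≡⟨ solve 3 (λ a b c → a :* (b :* c) := a :* c :* b) refl (multinomial n js) (1/factorials js) (ι (factorials js)) ⟩
    multinomial n js * ι (factorials js) * 1/factorials js        ≡⟨ cong (_* 1/factorials js) (/-*-cancel (n !) (factorials js) {{factorials≢0 js}}) ⟩
    ι (n !) * 1/factorials js                                     ∎

-- Coefficients of powers as sums over compositions

module Compositions {c ℓ} (R : CommutativeRing c ℓ) where
  open CommutativeRing R using (commutativeSemiring)
  open SemiringTheory commutativeSemiring hiding (zero)
  open PowerSeries commutativeSemiring renaming (commutativeSemiring to series)
  open SetoidReasoning setoid
  open Defs using (compositions)
  module Series = SemiringTheory series

  sumOver : {A : Set} → List A → (A → Carrier) → Carrier
  sumOver xs f = foldr (λ a s → f a + s) 0# xs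

  sumOver-cong : ∀ {A : Set} (xs : List A) {f g : A → Carrier} → (∀ a → f a ≈ g a) → sumOver xs f ≈ sumOver xs g
  sumOver-cong []       p = refl
  sumOver-cong (x ∷ xs) p = +-cong (p x) (sumOver-cong xs p)

  sumOver-++ : ∀ {A : Set} (xs ys : List A) f → sumOver (xs ++ ys) f ≈ sumOver xs f + sumOver ys f
  sumOver-++ []       ys f = sym (+-identityˡ _)
  sumOver-++ (x ∷ xs) ys f = trans (+-congˡ (sumOver-++ xs ys f)) (sym (+-assoc _ _ _))

  sumOver-map : ∀ {A B : Set} (g : A → B) (xs : List A) f → sumOver (map g xs) f ≡ sumOver xs (f ∘ g)
  sumOver-map g []       f = ≡.refl
  sumOver-map g (x ∷ xs) f = cong (f (g x) +_) (sumOver-map g xs f)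

  sumOver-concatMap : ∀ {A B : Set} (g : A → List B) (xs : List A) f →
                      sumOver (concatMap g xs) f ≈ sumOver xs (λ a → sumOver (g a) f)
  sumOver-concatMap g []       f = refl
  sumOver-concatMap g (x ∷ xs) f = trans (sumOver-++ (g x) (concatMap g xs) f) (+-congˡ (sumOver-concatMap g xs f))

  *-distribˡ-sumOver : ∀ {A : Set} k (xs : List A) f → k * sumOver xs f ≈ sumOver xs (λ a → k * f a)
  *-distribˡ-sumOver k []       f = zeroʳ k
  *-distribˡ-sumOver k (x ∷ xs) f = trans (distribˡ _ _ _) (+-congˡ (*-distribˡ-sumOver k xs f))

  -- The tail of `upTo` is an `applyUpTo` of a shifted function. The general `p` makes the induction
  -- go through; the use is with the identity.
  ⊛-sumOver : ∀ a b n (p : ℕ → ℕ) (f : ℕ → Carrier) → (∀ i → f (p i) ≈ a i * b (n ∸ i)) →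
              (a ⊛ b) n ≈ sumOver (applyUpTo p (suc n)) f
  ⊛-sumOver a b zero    p f e = trans (sym (e 0)) (sym (+-identityʳ (f (p 0))))
  ⊛-sumOver a b (suc n) p f e = +-cong (sym (e 0)) (⊛-sumOver (a ∘ suc) b n (p ∘ suc) f (e ∘ suc))

  ^-compositions : ∀ m a n → (a Series.^ m) n ≈ sumOver (compositions m n) (λ js → product (λ i → a (lookup js i)))
  ^-compositions zero    a zero    = sym (+-identityʳ 1#)
  ^-compositions zero    a (suc n) = refl
  ^-compositions (suc m) a n       = begin
    (a ⊛ a Series.^ m) n
      ≈⟨ ⊛-sumOver a (a Series.^ m) n id _ (λ _ → refl) ⟩
    sumOver (upTo (suc n)) (λ j → a j * (a Series.^ m) (n ∸ j))
      ≈⟨ sumOver-cong (upTo (suc n)) first ⟩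
    sumOver (upTo (suc n)) (λ j → sumOver (map (j ∷_) (compositions m (n ∸ j))) f)
      ≈⟨ sumOver-concatMap (λ j → map (j ∷_) (compositions m (n ∸ j))) (upTo (suc n)) f ⟨
    sumOver (compositions (suc m) n) f ∎
    where
    f : ∀ {m} → Vec ℕ m → Carrier
    f js = product (λ i → a (lookup js i))
    first : ∀ j → a j * (a Series.^ m) (n ∸ j) ≈ sumOver (map (j ∷_) (compositions m (n ∸ j))) f
    first j = begin
      a j * (a Series.^ m) (n ∸ j)
        ≈⟨ *-congˡ (^-compositions m a (n ∸ j)) ⟩
      a j * sumOver (compositions m (n ∸ j)) f
        ≈⟨ *-distribˡ-sumOver (a j) (compositions m (n ∸ j)) f ⟩
      sumOver (compositions m (n ∸ j)) (λ js → a j * f js)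
        ≡⟨ sumOver-map (j ∷_) (compositions m (n ∸ j)) f ⟨
      sumOver (map (j ∷_) (compositions m (n ∸ j))) f ∎

-- The formula over any commutative ring that receives ℚ

module FubiniDerivatives {c ℓ} (R : CommutativeRing c ℓ) (φ : ℚ → CommutativeRing.Carrier R)
  (φ-homo : IsSemiringHomomorphism ℚₚ.+-*-rawSemiring (CommutativeSemiring.rawSemiring (CommutativeRing.commutativeSemiring R)) φ) where
  open CommutativeRing R using (commutativeSemiring; -_)
  open SemiringTheory commutativeSemiring hiding (zero)
  open PowerSeries commutativeSemiring renaming (commutativeSemiring to series)
  open IsSemiringHomomorphism φ-homo using (+-homo; *-homo; 0#-homo; 1#-homo)
  open Compositions R using (sumOver; sumOver-cong; *-distribˡ-sumOver; ^-compositions)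
  open Composition R using (mono; G; G-expansion)
  open Multinomial using (1/factorials; multinomial≡)
  open SetoidReasoning setoid
  open SemiringSolver commutativeSemiring using (solve; _:+_; _:*_; _:=_)
  open Defs using (compositions; multinomial)
  open Defs.Central using (ι; T)
  open Defs.Central.Expansion using (ι-suc)
  open CentralSeries using (1/!_; 1/!-inverse; 2sinh; k!T≡n!2sinh^k)
  module Series = SemiringTheory series
  module ℚSeries = PowerSeries (CommutativeRing.commutativeSemiring ℚₚ.+-*-commutativeRing)

  φ-⊛ : ∀ a b n → φ ((a ℚSeries.⊛ b) n) ≈ ((φ ∘ a) ⊛ (φ ∘ b)) n
  φ-⊛ a b zero    = *-homo (a 0) (b 0)
  φ-⊛ a b (suc n) = trans (+-homo (a 0 Rat.* b (suc n)) ((a ∘ suc ℚSeries.⊛ b) n))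
    (+-cong (*-homo (a 0) (b (suc n))) (φ-⊛ (a ∘ suc) b n))

  φ-^ : ∀ a k n → φ ((a CentralSeries.Series.^ k) n) ≈ ((φ ∘ a) Series.^ k) n
  φ-^ a zero    zero    = 1#-homo
  φ-^ a zero    (suc n) = 0#-homo
  φ-^ a (suc k) n       = trans (φ-⊛ a (a CentralSeries.Series.^ k) n)
    (⊛-cong {φ ∘ a} (λ _ → refl) (φ-^ a k) n)

  φι-* : ∀ m a → φ (ι m) * a ≈ m × a
  φι-* zero    a = trans (*-congʳ 0#-homo) (zeroˡ a)
  φι-* (suc m) a = begin
    φ (ι (suc m)) * a              ≡⟨ cong (λ q → φ q * a) (ι-suc m) ⟩
    φ (1ℚ Rat.+ ι m) * a           ≈⟨ *-congʳ (+-homo 1ℚ (ι m)) ⟩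
    (φ 1ℚ + φ (ι m)) * a           ≈⟨ distribʳ a _ _ ⟩
    φ 1ℚ * a + φ (ι m) * a         ≈⟨ +-cong (trans (*-congʳ 1#-homo) (*-identityˡ a)) (φι-* m a) ⟩
    a + m × a                      ∎

  h : Series
  h = φ ∘ 2sinh

  -- The r-th derivative of centralFubini n at x.
  fubini : ℕ → ℕ → Carrier → Carrier
  fubini r n x = ∑[ k ≤ n ] (φ (ι (toℕ k !) Rat.* T n (toℕ k)) * mono x (toℕ k) r)

  fubini≈G : ∀ r n x → fubini r n x ≈ φ (ι (n !)) * G h 0#-homo x r n
  fubini≈G r n x = trans (sum-cong-≋ {suc n} (λ k → term (toℕ k)))
    (sym (*-distribˡ-sum {suc n} (φ (ι (n !))) (λ k → (h Series.^ toℕ k) n * mono x (toℕ k) r)))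
    where
    term : ∀ k → φ (ι (k !) Rat.* T n k) * mono x k r ≈ φ (ι (n !)) * ((h Series.^ k) n * mono x k r)
    term k = begin
      φ (ι (k !) Rat.* T n k) * mono x k r
        ≡⟨ cong (λ q → φ q * mono x k r) (k!T≡n!2sinh^k n k) ⟩
      φ (ι (n !) Rat.* (2sinh CentralSeries.Series.^ k) n) * mono x k r
        ≈⟨ *-congʳ (trans (*-homo (ι (n !)) ((2sinh CentralSeries.Series.^ k) n)) (*-congˡ (φ-^ 2sinh k n))) ⟩
      φ (ι (n !)) * (h Series.^ k) n * mono x k r
        ≈⟨ *-assoc _ _ _ ⟩
      φ (ι (n !)) * ((h Series.^ k) n * mono x k r) ∎

  module _ (x : Carrier) where
    private
      F = λ n → fubini 0 n x
      G₀ = G h 0#-homo x 0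

    G≈fubini : ∀ n → G₀ n ≈ φ (1/! n) * F n
    G≈fubini n = sym (begin
      φ (1/! n) * F n                      ≈⟨ *-congˡ (fubini≈G 0 n x) ⟩
      φ (1/! n) * (φ (ι (n !)) * G₀ n)     ≈⟨ *-assoc _ _ _ ⟨
      φ (1/! n) * φ (ι (n !)) * G₀ n       ≈⟨ *-congʳ (*-homo (1/! n) (ι (n !))) ⟨
      φ (1/! n Rat.* ι (n !)) * G₀ n       ≡⟨ cong (λ q → φ q * G₀ n) (1/!-inverse n) ⟩
      φ 1ℚ * G₀ n                          ≈⟨ *-congʳ 1#-homo ⟩
      1# * G₀ n                            ≈⟨ *-identityˡ _ ⟩
      G₀ n                                 ∎)

    product-G : ∀ {m} (js : Vec ℕ m) → product (λ i → G₀ (lookup js i)) ≈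
                φ (1/factorials js) * product (λ i → F (lookup js i))
    product-G []       = sym (trans (*-identityʳ _) 1#-homo)
    product-G (j ∷ js) = begin
      G₀ j * product (λ i → G₀ (lookup js i))
        ≈⟨ *-cong (G≈fubini j) (product-G js) ⟩
      (φ (1/! j) * F j) * (φ (1/factorials js) * product (λ i → F (lookup js i)))
        ≈⟨ solve 4 (λ a b c d → (a :* b) :* (c :* d) := (a :* c) :* (b :* d)) refl _ _ _ _ ⟩
      (φ (1/! j) * φ (1/factorials js)) * (F j * product (λ i → F (lookup js i)))
        ≈⟨ *-congʳ (*-homo (1/! j) (1/factorials js)) ⟨
      φ (1/factorials (j ∷ js)) * product (λ i → F (lookup (j ∷ js) i)) ∎

    convolutionPower : ℕ → ℕ → Carrier
    convolutionPower m n = sumOver (compositions m n) (λ js → φ (multinomial n js) * product (λ i → F (lookup js i)))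

    -- A product of m exponential generating functions: the factors 1/j! of the coefficients of `G₀`
    -- combine with n! to the multinomial coefficient.
    n!G^m : ∀ m n → φ (ι (n !)) * (G₀ Series.^ m) n ≈ convolutionPower m n
    n!G^m m n = begin
      φ (ι (n !)) * (G₀ Series.^ m) n
        ≈⟨ *-congˡ (^-compositions m G₀ n) ⟩
      φ (ι (n !)) * sumOver (compositions m n) (λ js → product (λ i → G₀ (lookup js i)))
        ≈⟨ *-distribˡ-sumOver (φ (ι (n !))) (compositions m n) _ ⟩
      sumOver (compositions m n) (λ js → φ (ι (n !)) * product (λ i → G₀ (lookup js i)))
        ≈⟨ sumOver-cong (compositions m n) term ⟩
      convolutionPower m n ∎
      where
      term : ∀ {m} (js : Vec ℕ m) → φ (ι (n !)) * product (λ i → G₀ (lookup js i)) ≈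
             φ (multinomial n js) * product (λ i → F (lookup js i))
      term js = begin
        φ (ι (n !)) * product (λ i → G₀ (lookup js i))
          ≈⟨ *-congˡ (product-G js) ⟩
        φ (ι (n !)) * (φ (1/factorials js) * product (λ i → F (lookup js i)))
          ≈⟨ *-assoc _ _ _ ⟨
        φ (ι (n !)) * φ (1/factorials js) * product (λ i → F (lookup js i))
          ≈⟨ *-congʳ (*-homo (ι (n !)) (1/factorials js)) ⟨
        φ (ι (n !) Rat.* 1/factorials js) * product (λ i → F (lookup js i))
          ≡⟨ cong (λ q → φ q * product (λ i → F (lookup js i))) (multinomial≡ n js) ⟨
        φ (multinomial n js) * product (λ i → F (lookup js i)) ∎

    fubini-formula : ∀ y → x * y ≈ 1# → ∀ r n → fubini r n x ≈
      φ (ι (r !)) * y ^ r * ∑[ k ≤ r ] (φ (ι (r C toℕ k)) * (- 1#) ^ (r ∸ toℕ k) * convolutionPower (suc (toℕ k)) n)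
    fubini-formula y xy≈1 r n = begin
      fubini r n x
        ≈⟨ fubini≈G r n x ⟩
      N * G h 0#-homo x r n
        ≈⟨ *-identityˡ _ ⟨
      1# * (N * G h 0#-homo x r n)
        -- Here `y` plays 1/x. The factor 1 = xʳ yʳ is inserted because `G-expansion` evaluates only
        -- the multiple xʳ Gᵣ.
        ≈⟨ *-congʳ (trans (sym (^-distrib-* x y r)) (trans (^-congˡ r xy≈1) (1^ r))) ⟨
      (x ^ r * y ^ r) * (N * G h 0#-homo x r n)
        ≈⟨ solve 4 (λ a b c d → (a :* b) :* (c :* d) := b :* (c :* (a :* d))) refl _ _ _ _ ⟩
      y ^ r * (N * (x ^ r * G h 0#-homo x r n))
        ≈⟨ *-congˡ (*-congˡ (G-expansion h 0#-homo x r n)) ⟩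
      y ^ r * (N * ((r !) × ∑[ k ≤ r ] (g k)))
        ≈⟨ *-congˡ (*-congˡ (φι-* (r !) (∑[ k ≤ r ] (g k)))) ⟨
      y ^ r * (N * (φ (ι (r !)) * ∑[ k ≤ r ] (g k)))
        ≈⟨ solve 4 (λ a b c d → a :* (b :* (c :* d)) := c :* a :* (b :* d)) refl _ _ _ _ ⟩
      φ (ι (r !)) * y ^ r * (N * ∑[ k ≤ r ] (g k))
        ≈⟨ *-congˡ (*-distribˡ-sum {suc r} N g) ⟩
      φ (ι (r !)) * y ^ r * ∑[ k ≤ r ] (N * g k)
        ≈⟨ *-congˡ (sum-cong-≋ {suc r} (λ k → term (r C toℕ k) (r ∸ toℕ k) (suc (toℕ k)))) ⟩
      φ (ι (r !)) * y ^ r * ∑[ k ≤ r ] (φ (ι (r C toℕ k)) * (- 1#) ^ (r ∸ toℕ k) * convolutionPower (suc (toℕ k)) n) ∎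
      where
      open Exponentiation commutativeSemiring using (^-distrib-*)
      N = φ (ι (n !))
      g : Fin (suc r) → Carrier
      g k = (r C toℕ k) × ((- 1#) ^ (r ∸ toℕ k) * (G₀ Series.^ suc (toℕ k)) n)
      1^ : ∀ m → 1# ^ m ≈ 1#
      1^ zero    = refl
      1^ (suc m) = trans (*-identityˡ _) (1^ m)
      term : ∀ a b m → N * (a × ((- 1#) ^ b * (G₀ Series.^ m) n)) ≈ φ (ι a) * (- 1#) ^ b * convolutionPower m n
      term a b m = begin
        N * (a × ((- 1#) ^ b * (G₀ Series.^ m) n))
          ≈⟨ *-congˡ (φι-* a _) ⟨
        N * (φ (ι a) * ((- 1#) ^ b * (G₀ Series.^ m) n))
          ≈⟨ solve 4 (λ n a b g → n :* (a :* (b :* g)) := a :* b :* (n :* g)) refl _ _ _ _ ⟩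
        φ (ι a) * (- 1#) ^ b * (N * (G₀ Series.^ m) n)
          ≈⟨ *-congˡ (n!G^m m n) ⟩
        φ (ι a) * (- 1#) ^ b * convolutionPower m n ∎

  fubini-presentation : ∀ mul pow (Σ : ∀ n → (Fin (suc n) → Carrier) → Carrier) (F : ℕ → Carrier → Carrier) →
    mul ≡ _*_ → pow ≡ _^_ → Σ ≡ (λ n → sum {suc n}) →
    F ≡ (λ n x → Σ n (λ k → mul (φ (ι (toℕ k !) Rat.* T n (toℕ k))) (pow x (toℕ k)))) →
    F ≡ fubini 0
  fubini-presentation mul pow Σ F ≡.refl ≡.refl ≡.refl ≡.refl = ≡.refl

  -- Here mul, pow, Σ, … are the operations of ℝ as the theorem names them. Identifying them
  -- with those of R inside a large term unfolds ℝ and ℚ, so it is done one operation at a time.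
  formula-presentation : ∀ mul neg one (Σ∈ : ∀ m → List (Vec ℕ m) → (Vec ℕ m → Carrier) → Carrier)
    (F : ℕ → Carrier → Carrier) (J : ℕ → ℕ → Carrier → Carrier)
    {pow : Carrier → ℕ → Carrier} {Σ : ∀ n → (Fin (suc n) → Carrier) → Carrier} {Π : ∀ n → (Fin n → Carrier) → Carrier} →
    mul ≡ _*_ → neg ≡ -_ → one ≡ 1# → Σ∈ ≡ (λ m → sumOver {Vec ℕ m}) → F ≡ fubini 0 → J ≡ fubini →
    (∀ x n → pow x n ≡ x ^ n) → (∀ n f → Σ n f ≡ sum {suc n} f) → (∀ n f → Π n f ≡ product {n} f) →
    ∀ x y → mul x y ≈ one → ∀ r n → J r n x ≈
      mul (mul (φ (ι (r !))) (pow y r))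
        (Σ r λ k → mul (mul (φ (ι (r C toℕ k))) (pow (neg one) (r ∸ toℕ k)))
          (Σ∈ (suc (toℕ k)) (compositions (suc (toℕ k)) n) λ js →
            mul (φ (multinomial n js)) (Π (suc (toℕ k)) λ i → F (lookup js i) x)))
  formula-presentation mul neg one Σ∈ F J ≡.refl ≡.refl ≡.refl ≡.refl ≡.refl ≡.refl pow≡ Σ≡ Π≡ x y xy≈1 r n = trans
    (fubini-formula x y xy≈1 r n)
    (*-cong (*-congˡ (reflexive (≡.sym (pow≡ y r)))) (trans
      (sum-cong-≋ {suc r} λ k → *-cong (*-congˡ {φ (ι (r C toℕ k))} (reflexive (≡.sym (pow≡ (- 1#) (r ∸ toℕ k)))))
        (sumOver-cong (compositions (suc (toℕ k)) n) λ js → *-congˡ {φ (multinomial n js)} (reflexive (≡.sym (Π≡ (suc (toℕ k)) (λ i → fubini 0 (lookup js i) x))))))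
      (reflexive (≡.sym (Σ≡ r _)))))

-- Second-order expansions of polynomials

module Expansions {c ℓ} (R : CommutativeRing c ℓ)
  (LocallyBounded : (CommutativeRing.Carrier R → CommutativeRing.Carrier R) → CommutativeRing.Carrier R → Set)
  (const-bounded : ∀ k x → LocallyBounded (λ _ → k) x)
  (increment-bounded : ∀ x → LocallyBounded (λ y → CommutativeRing._-_ R y x) x)
  (+-bounded : ∀ f g x → LocallyBounded f x → LocallyBounded g x → LocallyBounded (λ y → CommutativeRing._+_ R (f y) (g y)) x)
  (*-bounded : ∀ f g x → LocallyBounded f x → LocallyBounded g x → LocallyBounded (λ y → CommutativeRing._*_ R (f y) (g y)) x)
  where
  open CommutativeRing R using (commutativeSemiring; _-_; -‿inverseˡ)
  open SemiringTheory commutativeSemiring hiding (zero)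
  open SemiringSolver commutativeSemiring using (solve; _:+_; _:*_; _:=_)
  open Composition R using (mono)

  -- A second-order remainder with a locally bounded quotient is stronger than
  -- differentiability, holds for all polynomials, and composes by pure algebra.
  record HasExpansionAt (f : Carrier → Carrier) (x L : Carrier) : Set (c ⊔ ℓ) where
    field
      quotient  : Carrier → Carrier
      bounded   : LocallyBounded quotient x
      expansion : ∀ y → f y ≈ f x + (y - x) * (L + (y - x) * quotient y)
  open HasExpansionAt

  resp-≈ : ∀ {f x L M} → L ≈ M → HasExpansionAt f x L → HasExpansionAt f x M
  resp-≈ L≈M E = record
    { quotient  = quotient E
    ; bounded   = bounded E
    ; expansion = λ y → trans (expansion E y) (+-congˡ (*-congˡ (+-congʳ L≈M)))
    }

  const-expands : ∀ k x → HasExpansionAt (λ _ → k) x 0#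
  const-expands k x = record
    { quotient  = λ _ → 0#
    ; bounded   = const-bounded 0# x
    ; expansion = λ y → sym (trans (+-congˡ (trans (*-congˡ (trans (+-identityˡ _) (zeroʳ _))) (zeroʳ _))) (+-identityʳ k))
    }

  +-expands : ∀ {f g x L M} → HasExpansionAt f x L → HasExpansionAt g x M → HasExpansionAt (λ y → f y + g y) x (L + M)
  +-expands {x = x} E F = record
    { quotient  = λ y → quotient E y + quotient F y
    ; bounded   = +-bounded (quotient E) (quotient F) x (bounded E) (bounded F)
    ; expansion = λ y → trans (+-cong (expansion E y) (expansion F y))
        (solve 7 (λ d f L r g M s → (f :+ d :* (L :+ d :* r)) :+ (g :+ d :* (M :+ d :* s)) :=
                                    (f :+ g) :+ d :* ((L :+ M) :+ d :* (r :+ s))) refl _ _ _ _ _ _ _)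
    }

  *-expands : ∀ {f x L} k → HasExpansionAt f x L → HasExpansionAt (λ y → k * f y) x (k * L)
  *-expands {x = x} k E = record
    { quotient  = λ y → k * quotient E y
    ; bounded   = *-bounded (λ _ → k) (quotient E) x (const-bounded k x) (bounded E)
    ; expansion = λ y → trans (*-congˡ (expansion E y))
        (solve 5 (λ k d f L r → k :* (f :+ d :* (L :+ d :* r)) := k :* f :+ d :* (k :* L :+ d :* (k :* r))) refl _ _ _ _ _)
    }

  id*-expands : ∀ {f x L} → HasExpansionAt f x L → HasExpansionAt (λ y → y * f y) x (x * L + f x)
  id*-expands {f} {x} {L} E = record
    -- With d = y - x and quotient q, the product (x + d) (f + d (L + d q)) equals x f + d ((x L +
    -- f) + d (L + (x + d) q)). Writing y as x + d lets the semiring solver treat d as an atom.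
    { quotient  = λ y → L + (x + (y - x)) * quotient E y
    ; bounded   = +-bounded (λ _ → L) (λ y → (x + (y - x)) * quotient E y) x (const-bounded L x)
        (*-bounded (λ y → x + (y - x)) (quotient E) x
          (+-bounded (λ _ → x) (λ y → y - x) x (const-bounded x x) (increment-bounded x)) (bounded E))
    ; expansion = λ y → trans (*-cong (y≈x+[y-x] y) (expansion E y))
        (solve 5 (λ x d f L r → (x :+ d) :* (f :+ d :* (L :+ d :* r)) :=
                                x :* f :+ d :* ((x :* L :+ f) :+ d :* (L :+ (x :+ d) :* r))) refl x (y - x) (f x) L (quotient E y))
    }
    where
    y≈x+[y-x] : ∀ y → y ≈ x + (y - x)
    y≈x+[y-x] y = sym (trans (+-comm x (y - x)) (trans (+-assoc y _ x) (trans (+-congˡ (-‿inverseˡ x)) (+-identityʳ y))))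

  ×-expands : ∀ {f x L} m → HasExpansionAt f x L → HasExpansionAt (λ y → m × f y) x (m × L)
  ×-expands zero    E = const-expands 0# _
  ×-expands (suc m) E = +-expands E (×-expands m E)

  sum-expands : ∀ m {f : Fin m → Carrier → Carrier} {x} {L : Fin m → Carrier} →
                (∀ i → HasExpansionAt (f i) x (L i)) → HasExpansionAt (λ y → sum (λ i → f i y)) x (sum L)
  sum-expands zero    E = const-expands 0# _
  sum-expands (suc m) E = +-expands (E fzero) (sum-expands m (E ∘ fsuc))

  -- In the last case, differentiating the factor y contributes one more copy of `mono x k (suc r)`,
  -- which raises the multiplicity from r + 1 to r + 2.
  mono-expands : ∀ k r x → HasExpansionAt (λ y → mono y k r) x (mono x k (suc r))
  mono-expands zero    zero    x = const-expands 1# x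
  mono-expands zero    (suc r) x = const-expands 0# x
  mono-expands (suc k) zero    x = resp-≈ (+-congˡ (sym (+-identityʳ _))) (id*-expands (mono-expands k 0 x))
  mono-expands (suc k) (suc r) x = resp-≈ (+-assoc _ _ _)
    (+-expands (id*-expands (mono-expands k (suc r) x)) (×-expands (suc r) (mono-expands k r x)))

  module _ (φ : ℚ → Carrier) (φ-homo : IsSemiringHomomorphism ℚₚ.+-*-rawSemiring rawSemiring φ) where
    open FubiniDerivatives R φ φ-homo using (fubini)
    open Defs using (ι; T)

    fubini-expands : ∀ n r x → HasExpansionAt (fubini r n) x (fubini (suc r) n x)
    fubini-expands n r x = sum-expands (suc n) λ k →
      *-expands (φ (ι (toℕ k !) Rat.* T n (toℕ k))) (mono-expands (toℕ k) r x)

-- Inequalities for the rational terms of Cauchy sequences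

module RationalEstimates where
  open Rat hiding (ℚ; 0ℚ; 1ℚ; ½)
  open ℚₚ.≤-Reasoning
  open +-*-Solver

  ∣+∣-mono-≤ : ∀ {p q A B} → ∣ p ∣ ≤ A → ∣ q ∣ ≤ B → ∣ p + q ∣ ≤ A + B
  ∣+∣-mono-≤ {p} {q} p≤A q≤B = ℚₚ.≤-trans (ℚₚ.∣p+q∣≤∣p∣+∣q∣ p q) (ℚₚ.+-mono-≤ p≤A q≤B)

  ∣*∣-mono-≤ : ∀ {p q A B} → ∣ p ∣ ≤ A → ∣ q ∣ ≤ B → ∣ p * q ∣ ≤ A * B
  ∣*∣-mono-≤ {p} {q} {A} {B} p≤A q≤B = begin
    ∣ p * q ∣       ≡⟨ ℚₚ.∣p*q∣≡∣p∣*∣q∣ p q ⟩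
    ∣ p ∣ * ∣ q ∣   ≤⟨ ℚₚ.*-monoʳ-≤-nonNeg ∣ q ∣ {{ℚₚ.∣-∣-nonNeg q}} p≤A ⟩
    A * ∣ q ∣       ≤⟨ ℚₚ.*-monoˡ-≤-nonNeg A {{nonNegative (ℚₚ.≤-trans (ℚₚ.0≤∣p∣ p) p≤A)}} q≤B ⟩
    A * B           ∎

  -- An equality of reals holds termwise only up to some `η`. Beyond that the error is r d², bounded
  -- by B δ times the absolute value of d, and B δ ≤ c ≤ e.
  linearisation-error : ∀ {f f₀ l d r e B δ c η} → ∣ f - (f₀ + d * (l + d * r)) ∣ < η →
    ∣ r ∣ ≤ B → ∣ d ∣ ≤ δ → B * δ ≤ c → c ≤ e → ∣ (f - f₀) - l * d ∣ < e * ∣ d ∣ + η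
  linearisation-error {f} {f₀} {l} {d} {r} {e} {B} {δ} {c} {η} close r≤B d≤δ Bδ≤c c≤e = begin-strict
    ∣ (f - f₀) - l * d ∣
      ≡⟨ cong ∣_∣ (solve 5 (λ f f₀ l d r → (f :- f₀) :- l :* d :=
           r :* d :* d :+ (f :- (f₀ :+ d :* (l :+ d :* r)))) ≡.refl f f₀ l d r) ⟩
    ∣ r * d * d + (f - (f₀ + d * (l + d * r))) ∣
      ≤⟨ ℚₚ.∣p+q∣≤∣p∣+∣q∣ (r * d * d) (f - (f₀ + d * (l + d * r))) ⟩
    ∣ r * d * d ∣ + ∣ f - (f₀ + d * (l + d * r)) ∣
      ≤⟨ ℚₚ.+-monoˡ-≤ ∣ f - (f₀ + d * (l + d * r)) ∣ (∣*∣-mono-≤ {r * d} {d}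
           (ℚₚ.≤-trans (∣*∣-mono-≤ {r} {d} r≤B d≤δ) (ℚₚ.≤-trans Bδ≤c c≤e)) (ℚₚ.≤-refl {∣ d ∣})) ⟩
    e * ∣ d ∣ + ∣ f - (f₀ + d * (l + d * r)) ∣
      <⟨ ℚₚ.+-monoʳ-< (e * ∣ d ∣) close ⟩
    e * ∣ d ∣ + η ∎

  0<p⊓q : ∀ {p q} → 0ℚ < p → 0ℚ < q → 0ℚ < p ⊓ q
  0<p⊓q {p} {q} 0<p 0<q with ℚₚ.⊓-sel p q
  ... | inj₁ e = ≡.subst (0ℚ <_) (≡.sym e) 0<p
  ... | inj₂ e = ≡.subst (0ℚ <_) (≡.sym e) 0<q

  ½p≤p : ∀ {p} → 0ℚ < p → ½ * p ≤ p
  ½p≤p {p} 0<p = begin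
    ½ * p             ≡⟨ ℚₚ.+-identityʳ (½ * p) ⟨
    ½ * p + 0ℚ        ≤⟨ ℚₚ.+-monoʳ-≤ (½ * p) (ℚₚ.<⇒≤ (Defs.Estimates.0<½* 0<p)) ⟩
    ½ * p + ½ * p     ≡⟨ Defs.Estimates.½+½ p ⟩
    p                 ∎

  p+q≤r⇒p≤r : ∀ {p q r} → 0ℚ < q → p + q ≤ r → p ≤ r
  p+q≤r⇒p≤r {p} {q} 0<q p+q≤r = ℚₚ.≤-trans
    (≡.subst (_≤ p + q) (ℚₚ.+-identityʳ p) (ℚₚ.+-monoʳ-≤ p (ℚₚ.<⇒≤ 0<q))) p+q≤r

-- Differentiation on the Cauchy reals

module Differentiation where
  open Defs
  open RationalEstimates

  eventually-zip : {P Q S : ℕ → Set} → (∀ n → P n → Q n → S n) → Eventually P → Eventually Q → Eventually S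
  eventually-zip f (M , p) (N , q) = M ℕ.⊔ N , λ n M⊔N≤n →
    f n (p n (ℕₚ.≤-trans (ℕₚ.m≤m⊔n M N) M⊔N≤n)) (q n (ℕₚ.≤-trans (ℕₚ.m≤n⊔m M N) M⊔N≤n))

  -- The rational bound is uniform over the unit ball around x, while the index from which the terms
  -- obey it may depend on y.
  LocallyBounded : (ℝ → ℝ) → ℝ → Set
  LocallyBounded f x = ∃[ B ] (0ℚ Rat.< B Product.× (∀ y → ∣ y - x ∣ < 1ℝ → Eventually λ n → Rat.∣ seq (f y) n ∣ Rat.≤ B))

  const-bounded : ∀ k x → LocallyBounded (λ _ → k) x
  const-bounded k x = let B , 0<B , k≤B = bound k in B , 0<B , λ _ _ → k≤B

  increment-bounded : ∀ x → LocallyBounded (λ y → y - x) x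
  increment-bounded x = 1ℚ , ℚₚ.positive⁻¹ 1ℚ , λ y (c , 0<c , N , p) → N , λ n N≤n →
    p+q≤r⇒p≤r {Rat.∣ seq y n Rat.- seq x n ∣} {c} {1ℚ} 0<c (p n N≤n)

  +-bounded : ∀ {f g x} → LocallyBounded f x → LocallyBounded g x → LocallyBounded (λ y → f y + g y) x
  +-bounded {f} {g} (A , 0<A , p) (B , 0<B , q) = A Rat.+ B , ℚₚ.+-mono-< {0ℚ} {A} {0ℚ} {B} 0<A 0<B , λ y near →
    eventually-zip (λ n → ∣+∣-mono-≤ {seq (f y) n} {seq (g y) n} {A} {B})
      (p y near) (q y near)

  *-bounded : ∀ {f g x} → LocallyBounded f x → LocallyBounded g x → LocallyBounded (λ y → f y * g y) x
  *-bounded {f} {g} (A , 0<A , p) (B , 0<B , q) =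
    A Rat.* B , ℚₚ.positive⁻¹ (A Rat.* B) {{ℚₚ.pos*pos⇒pos A {{Rat.positive 0<A}} B {{Rat.positive 0<B}}}} , λ y near →
    eventually-zip (λ n → ∣*∣-mono-≤ {seq (f y) n} {seq (g y) n} {A} {B}) (p y near) (q y near)

  open Expansions ℝ-commutativeRing LocallyBounded const-bounded increment-bounded
    (λ f g x → +-bounded {f} {g} {x}) (λ f g x → *-bounded {f} {g} {x}) using (HasExpansionAt; fubini-expands)
  open HasExpansionAt

  expansion⇒derivative : ∀ {f x L} → HasExpansionAt f x L → HasDerivativeAt f x L
  expansion⇒derivative {f} {x} {L} E ε (c , 0<c , ε≥c) =
    fromℚ δ′ , (δ′ , 0<p⊓q 0<δ (ℚₚ.positive⁻¹ 1ℚ) , 0 , λ _ _ → ℚₚ.≤-reflexive (ℚₚ.+-identityˡ δ′)) , estimate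
    where
    B = proj₁ (bounded E)
    tolerance = Defs.Estimates.*-tolerance {B} {c} (proj₁ (proj₂ (bounded E))) 0<c
    δ = proj₁ tolerance
    0<δ = proj₁ (proj₂ tolerance)
    Bδ≡½c = proj₂ (proj₂ tolerance)
    -- The bound 1 keeps y in the ball where the quotient is at most `B`; the bound `δ`, with B δ =
    -- c/2, keeps the remainder below the rational `c` that eventually lies under the terms of `ε`.
    δ′ = δ Rat.⊓ 1ℚ
    estimate : ∀ y → ∣ y - x ∣ < fromℚ δ′ → ∣ (f y - f x) - L * (y - x) ∣ ≤ ε * ∣ y - x ∣
    estimate y (b , 0<b , N , p) η 0<η = eventually-zip
      (λ n close ((d≤δ , q≤B) , c≤ε) →
        linearisation-error {seq (f y) n} {seq (f x) n} {seq L n} {seq y n Rat.- seq x n} {seq (quotient E y) n}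
          {seq ε n} {B} {δ} {c} {η} close q≤B d≤δ
          (ℚₚ.≤-trans (ℚₚ.≤-reflexive Bδ≡½c) (½p≤p 0<c))
          (≡.subst (Rat._≤ seq ε n) (ℚₚ.+-identityˡ c) c≤ε))
      (expansion E y η 0<η)
      (eventually-zip (λ n → _,_)
        (eventually-zip (λ n → _,_)
          (N , λ n N≤n → ℚₚ.≤-trans (p+q≤r⇒p≤r {Rat.∣ seq y n Rat.- seq x n ∣} {b} {δ′} 0<b (p n N≤n)) (ℚₚ.p⊓q≤p δ 1ℚ))
          (proj₂ (proj₂ (bounded E)) y (b , 0<b , N , λ n N≤n → ℚₚ.≤-trans (p n N≤n) (ℚₚ.p⊓q≤q δ 1ℚ))))
        ε≥c)

  -- `HasNthDerivativeAt` replaces f by f′ at each step, so the induction shifts the whole family.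
  -- The value at x enters only at order 0, which lets a formula valid at that x alone conclude.
  iterate-derivative : (J : ℕ → ℝ → ℝ) → (∀ r y → HasDerivativeAt (J r) y (J (suc r) y)) →
                       ∀ r {x L} → J r x ≈ L → HasNthDerivativeAt r (J 0) x L
  iterate-derivative J J′ zero    p = p
  iterate-derivative J J′ (suc r) p = J 1 , J′ 0 , iterate-derivative (J ∘ suc) (J′ ∘ suc) r p

  fromℚ-homo : IsSemiringHomomorphism ℚₚ.+-*-rawSemiring (CommutativeSemiring.rawSemiring (CommutativeRing.commutativeSemiring ℝ-commutativeRing)) fromℚ
  fromℚ-homo = record
    { isNearSemiringHomomorphism = record
      { +-isMonoidHomomorphism = record
        { isMagmaHomomorphism = record
          { isRelHomomorphism = record { cong = λ {p} {q} p≡q → ≗⇒≈ {fromℚ p} {fromℚ q} λ _ → p≡q }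
          ; homo = λ p q → ≗⇒≈ {fromℚ (p Rat.+ q)} {fromℚ p + fromℚ q} λ _ → ≡.refl
          }
        ; ε-homo = ≈-refl {0ℝ}
        }
      ; *-homo = λ p q → ≗⇒≈ {fromℚ (p Rat.* q)} {fromℚ p * fromℚ q} λ _ → ≡.refl
      }
    ; 1#-homo = ≈-refl {1ℝ}
    }

  open FubiniDerivatives ℝ-commutativeRing fromℚ fromℚ-homo public using (fubini; fubini-presentation; formula-presentation)

  fubini-derivative : ∀ n r x → HasDerivativeAt (fubini r n) x (fubini (suc r) n x)
  fubini-derivative n r x = expansion⇒derivative {fubini r n} {x} {fubini (suc r) n x}
    (fubini-expands fromℚ fromℚ-homo n r x)

-- Specialisation of the formula to the reals

open import Defs

centralFubini≡fubini : centralFubini ≡ Differentiation.fubini 0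
centralFubini≡fubini = Differentiation.fubini-presentation _*_ _^_ sum⁺-syntax centralFubini ≡.refl ≡.refl ≡.refl ≡.refl

centralFubini-derivative : ∀ n r {x L} → Differentiation.fubini r n x ≈ L → HasNthDerivativeAt r (centralFubini n) x L
centralFubini-derivative n r {x} {L} p = ≡.subst (λ f → HasNthDerivativeAt r f x L) (≡.cong-app (≡.sym centralFubini≡fubini) n)
  (Differentiation.iterate-derivative (λ r → Differentiation.fubini r n) (Differentiation.fubini-derivative n) r {x} {L} p)

module Generic = SemiringTheory (CommutativeRing.commutativeSemiring ℝ-commutativeRing)

^-presentation : ∀ x n → x ^ n ≡ x Generic.^ n
^-presentation x n = ≡.refl

∑-presentation : ∀ n (f : Fin (suc n) → ℝ) → ∑[ k ≤ n ] (f k) ≡ Generic.sum f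
∑-presentation n f = ≡.refl

product-presentation : ∀ n (f : Fin n → ℝ) → product f ≡ Generic.product f
product-presentation n f = ≡.refl

theorem7 : ∀ (n r : ℕ) (x : ℝ) (x#0 : x # 0ℝ) →
    HasNthDerivativeAt r (centralFubini n) x
      (fromℚ (ι (r !)) * inv x x#0 ^ r *
        ∑[ k ≤ r ]
          (fromℚ (ι (r C toℕ k)) * (- 1ℝ) ^ (r ∸ toℕ k) *
            ∑[ j ∈ compositions (suc (toℕ k)) n ]
              (fromℚ (multinomial n j) * product (λ i → centralFubini (lookup j i) x))))
theorem7 n r x x#0 = centralFubini-derivative n r
  (Differentiation.formula-presentation _*_ -_ 1ℝ (λ m → sumOver {Vec ℕ m}) centralFubini Differentiation.fubini
    ≡.refl ≡.refl ≡.refl ≡.refl centralFubini≡fubini ≡.refl ^-presentation ∑-presentation product-presentation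
    x (inv x x#0) (inv-inverse x x#0) r n)
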